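{- Let $p$ be an odd prime and let $s$ be an integer with $0\le s\le\frac{p-1}{2}$. Then $$\sum_{k=0}^{\frac{p-1}{2}}\frac{(q;q^2)_k\,(q;q^2)_{k+s}}{(q^2;q^2)_k\,(q^2;q^2)_{k+s}}\equiv \left(\frac{ -1}{p}\right)q^{\frac{1-p^2}{4}}\pmod{[p]^2}.$$
   Context: For an indeterminate $q$ and an integer $n\ge 0$: $(a;q)_0=1$ and $(a;q)_n=(1-a)(1-aq)\cdots(1-aq^{n-1})$. For a positive integer $p$, $[p]=\frac{1-q^p}{1-q}=1+q+\cdots+q^{p-1}$. For a prime $p$, $[p]$ is irreducible in $\mathbb{Q}[q]$; for rational functions $A,B$ of $q$ whose denominators are coprime to $[p]$, $A\equiv B\pmod{[p]^r}$ means that $A-B$, written in lowest terms, has numerator divisible by $[p]^r$ in $\mathbb{Q}[q]$. $\left(\frac{\cdot}{p}\right)$ denotes the Legendre symbol modulo $p$. -}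

module Defs where

open import Algebra.Bundles.Raw using (RawRing)
import Algebra.Definitions.RawSemiring as SemiringDefs
open import Data.Bool.Base using (if_then_else_)
open import Data.Fin.Base using (Fin; toℕ)
open import Data.Fin.Properties using (any?)
open import Data.Integer.Base as ℤ using (ℤ; +_; -[1+_]; 0ℤ; 1ℤ; -1ℤ)
open import Data.Integer.Divisibility.Signed using () renaming (_∣?_ to _∣ℤ?_)
open import Data.List.Base using (List; []; _∷_; map)
open import Data.Nat.Base as ℕ using (ℕ; zero; suc)
open import Data.Product.Base using (_×_; ∃-syntax)
open import Data.Rational.Base as ℚ using (ℚ; 0ℚ; 1ℚ)
open import Data.Rational.Properties as ℚ using ()
open import Function.Base using (_∘_)
open import Level using (0ℓ)
open import Relation.Binary.PropositionalEquality
  using (_≡_; _≢_; refl; sym; trans; cong; cong₂; module ≡-Reasoning)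
open import Relation.Nullary using (¬_; yes; no; does; contradiction)

-- Coefficient lists, constant term first.  Trailing zeros are allowed, so
-- equality is _≈_, not _≡_.

Poly : Set
Poly = List ℚ

coeff : Poly → ℕ → ℚ
coeff []      _       = 0ℚ
coeff (a ∷ P) zero    = a
coeff (a ∷ P) (suc n) = coeff P n

module Poly where

  infix  4 _≈_
  infixl 6 _+_
  infixl 7 _*_
  infix  8 -_

  record _≈_ (P Q : Poly) : Set where
    constructor coeffs-≡
    field coeff-≡ : ∀ n → coeff P n ≡ coeff Q n

  open _≈_ public

  _+_ : Poly → Poly → Poly
  []      + Q       = Q
  (a ∷ P) + []      = a ∷ P
  (a ∷ P) + (b ∷ Q) = (a ℚ.+ b) ∷ (P + Q)

  scale : ℚ → Poly → Poly
  scale c = map (c ℚ.*_)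

  -_ : Poly → Poly
  -_ = map (ℚ.-_)

  _*_ : Poly → Poly → Poly
  []      * Q = []
  (a ∷ P) * Q = scale a Q + (0ℚ ∷ P * Q)

  const : ℚ → Poly
  const c = c ∷ []

  q : Poly
  q = 0ℚ ∷ 1ℚ ∷ []

  rawRing : RawRing 0ℓ 0ℓ
  rawRing = record
    { Carrier = Poly
    ; _≈_ = _≈_ ; _+_ = _+_ ; _*_ = _*_ ; -_ = -_
    ; 0# = [] ; 1# = const 1ℚ
    }

  open RawRing rawRing public using (_≉_; 0#; 1#)
  open SemiringDefs (RawRing.rawSemiring rawRing) public
    using (_^_; _∣_; Coprime; sum)

open Poly using (q)

private

  coeff-+ : ∀ P Q n → coeff (P Poly.+ Q) n ≡ coeff P n ℚ.+ coeff Q n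
  coeff-+ []      Q       n       = sym (ℚ.+-identityˡ _)
  coeff-+ (a ∷ P) []      n       = sym (ℚ.+-identityʳ _)
  coeff-+ (a ∷ P) (b ∷ Q) zero    = refl
  coeff-+ (a ∷ P) (b ∷ Q) (suc n) = coeff-+ P Q n

  coeff-scale : ∀ c P n → coeff (Poly.scale c P) n ≡ c ℚ.* coeff P n
  coeff-scale c []      n       = sym (ℚ.*-zeroʳ c)
  coeff-scale c (a ∷ P) zero    = refl
  coeff-scale c (a ∷ P) (suc n) = coeff-scale c P n

  coeff-neg : ∀ P n → coeff (Poly.- P) n ≡ ℚ.- coeff P n
  coeff-neg []      n       = refl
  coeff-neg (a ∷ P) zero    = refl
  coeff-neg (a ∷ P) (suc n) = coeff-neg P n

  coeff-* : ∀ a P Q n → coeff ((a ∷ P) Poly.* Q) n ≡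
            a ℚ.* coeff Q n ℚ.+ coeff (0ℚ ∷ P Poly.* Q) n
  coeff-* a P Q n = trans (coeff-+ (Poly.scale a Q) _ n)
                          (cong (ℚ._+ _) (coeff-scale a Q n))

  coeff₀-* : ∀ P Q → coeff (P Poly.* Q) 0 ≡ coeff P 0 ℚ.* coeff Q 0
  coeff₀-* []      Q = sym (ℚ.*-zeroˡ (coeff Q 0))
  coeff₀-* (a ∷ P) Q = trans (coeff-* a P Q 0) (ℚ.+-identityʳ _)

  a*b≡0⇒b≡0 : ∀ {a b} → a ≢ 0ℚ → a ℚ.* b ≡ 0ℚ → b ≡ 0ℚ
  a*b≡0⇒b≡0 {a} {b} a≢0 ab≡0 = begin
    b                      ≡⟨ ℚ.*-identityˡ b ⟨
    1ℚ ℚ.* b               ≡⟨ cong (ℚ._* b) (ℚ.*-inverseˡ a) ⟨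
    ℚ.1/ a ℚ.* a ℚ.* b     ≡⟨ ℚ.*-assoc (ℚ.1/ a) a b ⟩
    ℚ.1/ a ℚ.* (a ℚ.* b)   ≡⟨ cong (ℚ.1/ a ℚ.*_) ab≡0 ⟩
    ℚ.1/ a ℚ.* 0ℚ          ≡⟨ ℚ.*-zeroʳ (ℚ.1/ a) ⟩
    0ℚ                     ∎
    where
    open ≡-Reasoning
    instance _ = ℚ.≢-nonZero a≢0

  0+-cancel : ∀ {x y} → x ≡ 0ℚ → x ℚ.+ y ≡ 0ℚ → y ≡ 0ℚ
  0+-cancel refl e = trans (sym (ℚ.+-identityˡ _)) e

  Vanishes : Poly → Set
  Vanishes P = ∀ n → coeff P n ≡ 0ℚ

  coeff-*-∷ : ∀ P {b} Q → b ≡ 0ℚ → ∀ n →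
              coeff (P Poly.* (b ∷ Q)) (suc n) ≡ coeff (P Poly.* Q) n
  coeff-*-∷ []      Q refl n = refl
  coeff-*-∷ (a ∷ P) Q refl n = begin
    coeff ((a ∷ P) Poly.* (0ℚ ∷ Q)) (suc n)
      ≡⟨ coeff-* a P (0ℚ ∷ Q) (suc n) ⟩
    a ℚ.* coeff Q n ℚ.+ coeff (P Poly.* (0ℚ ∷ Q)) n
      ≡⟨ cong (a ℚ.* coeff Q n ℚ.+_) (shift n) ⟩
    a ℚ.* coeff Q n ℚ.+ coeff (0ℚ ∷ P Poly.* Q) n
      ≡⟨ coeff-* a P Q n ⟨
    coeff ((a ∷ P) Poly.* Q) n ∎
    where
    open ≡-Reasoning
    shift : ∀ n → coeff (P Poly.* (0ℚ ∷ Q)) n ≡ coeff (0ℚ ∷ P Poly.* Q) n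
    shift zero    = trans (coeff₀-* P (0ℚ ∷ Q)) (ℚ.*-zeroʳ (coeff P 0))
    shift (suc n) = coeff-*-∷ P Q refl n

  cancelˡ-≢0 : ∀ {a} P Q → a ≢ 0ℚ → Vanishes ((a ∷ P) Poly.* Q) → Vanishes Q
  cancelˡ-≢0         P []      a≢0 v n = refl
  cancelˡ-≢0 {a = a} P (b ∷ Q) a≢0 v   = λ where
      zero    → b≡0
      (suc n) → cancelˡ-≢0 P Q a≢0
                  (λ m → trans (sym (coeff-*-∷ (a ∷ P) Q b≡0 m)) (v (suc m))) n
    where
    b≡0 : b ≡ 0ℚ
    b≡0 = a*b≡0⇒b≡0 a≢0 (trans (sym (coeff₀-* (a ∷ P) (b ∷ Q))) (v 0))

  cancelʳ : ∀ P Q → ¬ Vanishes Q → Vanishes (P Poly.* Q) → Vanishes P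
  cancelʳ []      Q Q≉0 v n = refl
  cancelʳ (a ∷ P) Q Q≉0 v with a ℚ.≟ 0ℚ
  ... | no a≢0   = contradiction (cancelˡ-≢0 P Q a≢0 v) Q≉0
  ... | yes refl = λ where
    zero    → refl
    (suc n) → cancelʳ P Q Q≉0
      (λ m → 0+-cancel (ℚ.*-zeroˡ (coeff Q (suc m)))
                       (trans (sym (coeff-* 0ℚ P Q (suc m))) (v (suc m)))) n

*-≉0 : ∀ {P Q} → P Poly.≉ Poly.0# → Q Poly.≉ Poly.0# → P Poly.* Q Poly.≉ Poly.0#
*-≉0 {P} {Q} P≉0 Q≉0 (Poly.coeffs-≡ v) =
  P≉0 (Poly.coeffs-≡ (cancelʳ P Q (Q≉0 ∘ Poly.coeffs-≡) v))

1≉0 : Poly.1# Poly.≉ Poly.0#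
1≉0 1≈0 = contradiction (Poly.coeff-≡ 1≈0 0) ℚ.1≢0

q≉0 : q Poly.≉ Poly.0#
q≉0 q≈0 = contradiction (Poly.coeff-≡ q≈0 1) ℚ.1≢0

q^≉0 : ∀ n → q Poly.^ n Poly.≉ Poly.0#
q^≉0 zero    = 1≉0
q^≉0 (suc n) = *-≉0 q≉0 (q^≉0 n)

q² : Poly
q² = q Poly.^ 2

infix 9 ⦅_⨾_⦆_

-- The q-shifted factorial (a;b)ₙ = (1 - a)(1 - ab)⋯(1 - abⁿ⁻¹).
⦅_⨾_⦆_ : Poly → Poly → ℕ → Poly
⦅ a ⨾ b ⦆ zero  = Poly.1#
⦅ a ⨾ b ⦆ suc n = ⦅ a ⨾ b ⦆ n Poly.* (Poly.1# Poly.+ Poly.- (a Poly.* b Poly.^ n))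

[_] : ℕ → Poly
[ n ] = Poly.sum {n} (λ i → q Poly.^ toℕ i)

⦅q²⨾q²⦆≉0 : ∀ n → ⦅ q² ⨾ q² ⦆ n Poly.≉ Poly.0#
⦅q²⨾q²⦆≉0 zero    = 1≉0
⦅q²⨾q²⦆≉0 (suc n) = *-≉0 (⦅q²⨾q²⦆≉0 n) λ f≈0 →
  contradiction (trans (sym constant-term) (Poly.coeff-≡ f≈0 0)) ℚ.1≢0
  where
  open ≡-Reasoning
  X : Poly
  X = q² Poly.* q² Poly.^ n

  constant-term : coeff (Poly.1# Poly.+ Poly.- X) 0 ≡ 1ℚ
  constant-term = begin
    coeff (Poly.1# Poly.+ Poly.- X) 0  ≡⟨ coeff-+ Poly.1# (Poly.- X) 0 ⟩
    1ℚ ℚ.+ coeff (Poly.- X) 0          ≡⟨ cong (1ℚ ℚ.+_) (coeff-neg X 0) ⟩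
    1ℚ ℚ.+ ℚ.- coeff X 0               ≡⟨ cong (λ c → 1ℚ ℚ.+ ℚ.- c)
                                            (trans (coeff₀-* q² (q² Poly.^ n))
                                              (ℚ.*-zeroˡ (coeff (q² Poly.^ n) 0))) ⟩
    1ℚ                                 ∎

infix 5 _over_⟨_⟩

record RatFun : Set where
  constructor _over_⟨_⟩
  field
    num   : Poly
    den   : Poly
    den≉0 : den Poly.≉ Poly.0#

open RatFun public

module RF where

  infix  4 _≃_
  infixl 6 _+_ _-_
  infixl 7 _*_
  infix  8 -_
  infixr 8 q^_

  record _≃_ (A B : RatFun) : Set where
    constructor cross
    field cross-≈ : num A Poly.* den B Poly.≈ num B Poly.* den A

  open _≃_ public

  _+_ : RatFun → RatFun → RatFun
  A + B = num A Poly.* den B Poly.+ num B Poly.* den A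
    over den A Poly.* den B ⟨ *-≉0 (den≉0 A) (den≉0 B) ⟩

  _*_ : RatFun → RatFun → RatFun
  A * B = num A Poly.* num B over den A Poly.* den B ⟨ *-≉0 (den≉0 A) (den≉0 B) ⟩

  -_ : RatFun → RatFun
  - A = Poly.- num A over den A ⟨ den≉0 A ⟩

  _-_ : RatFun → RatFun → RatFun
  A - B = A + - B

  fromPoly : Poly → RatFun
  fromPoly P = P over Poly.1# ⟨ 1≉0 ⟩

  fromℤ : ℤ → RatFun
  fromℤ z = fromPoly (Poly.const (z ℚ./ 1))

  q^_ : ℤ → RatFun
  q^ (+ n)    = fromPoly (q Poly.^ n)
  q^ -[1+ n ] = Poly.1# over q Poly.^ suc n ⟨ q^≉0 (suc n) ⟩

  rawRing : RawRing 0ℓ 0ℓ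
  rawRing = record
    { Carrier = RatFun
    ; _≈_ = _≃_ ; _+_ = _+_ ; _*_ = _*_ ; -_ = -_
    ; 0# = fromPoly Poly.0# ; 1# = fromPoly Poly.1#
    }

  open SemiringDefs (RawRing.rawSemiring rawRing) public using (sum)

∑≤ : ℕ → (ℕ → RatFun) → RatFun
∑≤ n f = RF.sum {suc n} (λ k → f (toℕ k))

infixr 5 ∑≤
syntax ∑≤ n (λ k → A) = ∑[ k ≤ n ] A

record _IsLowestTermsOf_ (F A : RatFun) : Set where
  field
    equal   : A RF.≃ F
    reduced : Poly.Coprime (num F) (den F)

_HasDenominatorCoprimeTo_ : RatFun → Poly → Set
A HasDenominatorCoprimeTo P =
  ∃[ F ] F IsLowestTermsOf A × Poly.Coprime (den F) P

infix 3 _≡_[mod_^_]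

-- The relation is only meant for A and B with denominators coprime to P, so
-- that side condition is made part of it.
record _≡_[mod_^_] (A B : RatFun) (P : Poly) (r : ℕ) : Set where
  field
    denominatorˡ : A HasDenominatorCoprimeTo P
    denominatorʳ : B HasDenominatorCoprimeTo P
    difference   : ∃[ F ] F IsLowestTermsOf (A RF.- B) × (P Poly.^ r) Poly.∣ num F

legendre : ℤ → ℕ → ℤ
legendre a p =
  if does (+ p ∣ℤ? a) then 0ℤ
  else if does (any? {n = p} λ x → + p ∣ℤ? (+ toℕ x ℤ.* + toℕ x ℤ.- a)) then 1ℤ
  else -1ℤ

-- Write p = 2n + 1, Q = q² and ε = 1 - qᵖ.  Modulo [p]² we have ε² = 0, so y = q(1 + ε) is
-- Q⁻ⁿ and z = q(1 - ε) is Qⁿ⁺¹, and to first order in ε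
--   (y;Q)ₖ (z;Q)ₖ₊ₛ + (z;Q)ₖ (y;Q)ₖ₊ₛ = 2 (q;Q)ₖ (q;Q)ₖ₊ₛ.
-- Divided by (Q;Q)ₖ (Q;Q)ₖ₊ₛ and summed over k, each product on the left becomes a terminating
-- q-Chu-Vandermonde sum.  Up to the same unit both are the n-th q-difference
-- (T - Q)(T - Q²)⋯(T - Qⁿ), with T the shift, of a Gaussian binomial m ↦ [m choose n], which is
-- constantly 1.  Hence the sum is the inverse of (-1)ⁿ Q^(n(n+1)/2).  Finally (-1)ⁿ is the Legendre
-- symbol by a parity count of the fixed points of involutions on F_p^* / ±1.

module Submission where

open import Defs
open import Algebra.Bundles using (CommutativeRing)
import Algebra.Properties.CommutativeMonoid.Sum as MonoidSum
import Algebra.Properties.Ring as RingProperties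
import Algebra.Properties.Semiring.Exp as SemiringExp
import Algebra.Properties.Semiring.Mult.TCOptimised as SemiringMult
import Algebra.Properties.Semiring.Sum as SemiringSum
import Algebra.Solver.Ring as RingSolver
open import Algebra.Solver.Ring.AlmostCommutativeRing
  using (AlmostCommutativeRing; fromCommutativeRing; _-Raw-AlmostCommutative⟶_)
open import Data.Fin.Base as Fin using (Fin; toℕ; fromℕ<; zero; suc)
open import Data.Fin.Permutation using (Permutation′; permutation)
import Data.Fin.Properties as Fin
open import Data.Integer.Base as ℤ using (ℤ; +_; -[1+_]; 0ℤ; 1ℤ; -1ℤ)
import Data.Integer.DivMod as ℤ
open import Data.Integer.Divisibility.Signed as ℤ∣ using () renaming (_∣_ to _∣ℤ_; _∣?_ to _∣ℤ?_)
import Data.Integer.Properties as ℤ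
open import Data.List.Base using ([]; _∷_; length)
import Data.List.Properties as List
open import Data.Maybe.Base using (Maybe; just; nothing)
open import Data.Nat.Base as ℕ using (ℕ; zero; suc; _∸_; _≤_; _<_; s≤s; z≤n)
open import Data.Nat.Coprimality using (prime⇒coprime; coprime-Bézout)
open import Data.Nat.Divisibility as ℕ∣ using (_∣_; ∣m∣n⇒∣m+n; ∣-refl)
open import Data.Nat.DivMod using (_/_; _%_; m*n%n≡0; m*n/n≡m)
open import Data.Nat.GCD using (module Bézout)
open import Data.Nat.Primality using (Prime; euclidsLemma; prime⇒nonZero; ¬prime[1])
import Data.Nat.Properties as ℕ
open import Data.Nat.Tactic.RingSolver using (solve-∀)
open import Data.Product.Base using (_×_; _,_; ∃-syntax; proj₁; proj₂)
open import Data.Rational.Base as ℚ using (ℚ; 0ℚ; 1ℚ; ½)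
import Data.Rational.Properties as ℚ
open import Data.Sum.Base as Sum using (_⊎_; inj₁; inj₂)
open import Function.Base using (_∘_)
open import Level using (0ℓ; _⊔_)
open import Relation.Binary.Definitions using (tri<; tri≈; tri>)
open import Relation.Binary.PropositionalEquality as ≡ using (_≡_; _≢_)
import Relation.Binary.Reasoning.Setoid as SetoidReasoning
open import Relation.Binary.Structures using (IsEquivalence)
open import Relation.Nullary using (¬_; yes; no; contradiction)
open import Relation.Nullary.Decidable using (dec-false)

-- Modulo [p]^2 the base q is neither Q^(-n) nor Q^(n+1), the two values at which a sum closes, but
-- it is their mean: they are q moved by +ε and by -ε relative to q. Moving the two factors of a
-- summand in opposite directions still leaves a linear term when s > 0. Adding the opposite choice
-- cancels it, at the price of a factor 2, which is invertible over ℚ. The other obstacle is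
-- division. The argument needs (Q;Q)_k to be invertible modulo [p]^2 for all k ≤ 2n = p - 1. Modulo
-- [p] one has q^p = 1; there 1 - q divides p, and 1 - q^i divides 1 - q because i is invertible
-- modulo p. An inverse modulo [p] is then corrected to an inverse modulo [p]^2. Finally, the
-- congruence speaks of reduced fractions, while the calculation never reduces one: A/B has value x
-- when A = xB in the quotient ring. Passing to lowest terms is harmless because the cancelled
-- factor divides B, a unit.

module IntegerCoefficients {c ℓ} (R : CommutativeRing c ℓ) where

  open CommutativeRing R hiding (zero)
  open RingProperties ring
  open SemiringMult semiring renaming (_×_ to infixl 8 _·_)
  open SetoidReasoning setoid

  -- Equality in an arbitrary ring is undecidable, so the solver takes its coefficients from ℤ
  -- through this homomorphism. The multiples are the variant in which `1 · 1#` is `1#` itself, so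
  -- `con 1ℤ` and `1#` agree by `refl`.
  fromℤ : ℤ → Carrier
  fromℤ (+ n)    = n · 1#
  fromℤ -[1+ n ] = - (suc n · 1#)

  fromℤ-⊖ : ∀ m n → fromℤ (m ℤ.⊖ n) ≈ m · 1# - n · 1#
  fromℤ-⊖ m zero = begin
    m · 1#        ≈⟨ +-identityʳ _ ⟨
    m · 1# + 0#   ≈⟨ +-congˡ -0#≈0# ⟨
    m · 1# - 0#   ∎
  fromℤ-⊖ zero (suc n) = sym (+-identityˡ _)
  fromℤ-⊖ (suc m) (suc n) = begin
    fromℤ (suc m ℤ.⊖ suc n)                ≡⟨ ≡.cong fromℤ (ℤ.[1+m]⊖[1+n]≡m⊖n m n) ⟩
    fromℤ (m ℤ.⊖ n)                        ≈⟨ fromℤ-⊖ m n ⟩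
    m · 1# - n · 1#                        ≈⟨ +-congʳ (+-identityʳ _) ⟨
    m · 1# + 0# - n · 1#                   ≈⟨ +-congʳ (+-congˡ (-‿inverseʳ 1#)) ⟨
    m · 1# + (1# - 1#) - n · 1#            ≈⟨ +-congʳ (+-assoc _ _ _) ⟨
    m · 1# + 1# - 1# - n · 1#              ≈⟨ +-congʳ (+-congʳ (+-comm _ _)) ⟩
    1# + m · 1# - 1# - n · 1#              ≈⟨ +-assoc _ _ _ ⟩
    1# + m · 1# + (- 1# - n · 1#)          ≈⟨ +-congˡ (-‿+-comm _ _) ⟩
    (1# + m · 1#) - (1# + n · 1#)          ≈⟨ +-cong (1+× m 1#) (-‿cong (1+× n 1#)) ⟨
    suc m · 1# - suc n · 1#                ∎

  fromℤ-neg : ∀ i → fromℤ (ℤ.- i) ≈ - fromℤ i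
  fromℤ-neg (+ zero)  = sym -0#≈0#
  fromℤ-neg (+ suc n) = refl
  fromℤ-neg -[1+ n ]  = sym (-‿involutive _)

  fromℤ-+ : ∀ i j → fromℤ (i ℤ.+ j) ≈ fromℤ i + fromℤ j
  fromℤ-+ (+ m)    (+ n)    = ×-homo-+ 1# m n
  fromℤ-+ (+ m)    -[1+ n ] = fromℤ-⊖ m (suc n)
  fromℤ-+ -[1+ m ] (+ n)    = trans (fromℤ-⊖ n (suc m)) (+-comm _ _)
  fromℤ-+ -[1+ m ] -[1+ n ] = begin
    - (suc (suc (m ℕ.+ n)) · 1#)           ≡⟨ ≡.cong (λ k → - (suc k · 1#)) (ℕ.+-suc m n) ⟨
    - ((suc m ℕ.+ suc n) · 1#)             ≈⟨ -‿cong (×-homo-+ 1# (suc m) (suc n)) ⟩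
    - (suc m · 1# + suc n · 1#)            ≈⟨ -‿+-comm _ _ ⟨
    - (suc m · 1#) - suc n · 1#            ∎

  fromℤ-*ᵖ : ∀ m j → fromℤ (+ m ℤ.* j) ≈ (m · 1#) * fromℤ j
  fromℤ-*ᵖ zero    j = trans (reflexive (≡.cong fromℤ (ℤ.*-zeroˡ j))) (sym (zeroˡ _))
  fromℤ-*ᵖ (suc m) j = begin
    fromℤ (+ suc m ℤ.* j)                  ≡⟨ ≡.cong fromℤ (ℤ.suc-* (+ m) j) ⟩
    fromℤ (j ℤ.+ + m ℤ.* j)                ≈⟨ fromℤ-+ j (+ m ℤ.* j) ⟩
    fromℤ j + fromℤ (+ m ℤ.* j)            ≈⟨ +-cong (sym (*-identityˡ _)) (fromℤ-*ᵖ m j) ⟩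
    1# * fromℤ j + (m · 1#) * fromℤ j      ≈⟨ distribʳ _ _ _ ⟨
    (1# + m · 1#) * fromℤ j                ≈⟨ *-congʳ (1+× m 1#) ⟨
    (suc m · 1#) * fromℤ j                 ∎

  fromℤ-* : ∀ i j → fromℤ (i ℤ.* j) ≈ fromℤ i * fromℤ j
  fromℤ-* (+ m)    j = fromℤ-*ᵖ m j
  fromℤ-* -[1+ m ] j = begin
    fromℤ (-[1+ m ] ℤ.* j)                 ≡⟨ ≡.cong fromℤ (ℤ.neg-distribˡ-* (+ suc m) j) ⟨
    fromℤ (ℤ.- (+ suc m ℤ.* j))            ≈⟨ fromℤ-neg (+ suc m ℤ.* j) ⟩
    - fromℤ (+ suc m ℤ.* j)                ≈⟨ -‿cong (fromℤ-*ᵖ (suc m) j) ⟩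
    - ((suc m · 1#) * fromℤ j)             ≈⟨ -‿distribˡ-* _ _ ⟩
    - (suc m · 1#) * fromℤ j               ∎

  almostCommutativeRing : AlmostCommutativeRing c ℓ
  almostCommutativeRing = fromCommutativeRing R

  ℤ⟶R : ℤ.+-*-rawRing -Raw-AlmostCommutative⟶ almostCommutativeRing
  ℤ⟶R = record
    { ⟦_⟧    = fromℤ
    ; +-homo = fromℤ-+
    ; *-homo = fromℤ-*
    ; -‿homo = fromℤ-neg
    ; 0-homo = refl
    ; 1-homo = refl
    }

  _coeff≟_ : ∀ i j → Maybe (fromℤ i ≈ fromℤ j)
  i coeff≟ j with i ℤ.≟ j
  ... | yes i≡j = just (reflexive (≡.cong fromℤ i≡j))
  ... | no  _   = nothing

  open RingSolver ℤ.+-*-rawRing almostCommutativeRing ℤ⟶R _coeff≟_ public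
    using (solve; con; _:+_; _:*_; :-_; _:-_; _:=_)

-- Finite sums and q-shifted factorials in a commutative ring

module Summation {c ℓ} (R : CommutativeRing c ℓ) where

  open CommutativeRing R hiding (zero)
  open SetoidReasoning setoid
  open SemiringSum semiring using (sum; sum-cong-≋; *-distribˡ-sum; *-distribʳ-sum; ∑-distrib-+)

  ∑< : ℕ → (ℕ → Carrier) → Carrier
  ∑< n f = sum {n} (f ∘ toℕ)

  ∑<-cong : ∀ n {f g} → (∀ k → k < n → f k ≈ g k) → ∑< n f ≈ ∑< n g
  ∑<-cong n f≈g = sum-cong-≋ {n} λ i → f≈g (toℕ i) (Fin.toℕ<n i)

  ∑<-zero : ∀ n {f} → (∀ k → k < n → f k ≈ 0#) → ∑< n f ≈ 0#
  ∑<-zero zero    f≈0 = refl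
  ∑<-zero (suc n) f≈0 =
    trans (+-cong (f≈0 0 (s≤s z≤n)) (∑<-zero n λ k k<n → f≈0 (suc k) (s≤s k<n)))
          (+-identityˡ 0#)

  ∑<-+ : ∀ n f g → ∑< n (λ k → f k + g k) ≈ ∑< n f + ∑< n g
  ∑<-+ n f g = ∑-distrib-+ {n} (f ∘ toℕ) (g ∘ toℕ)

  ∑<-*ˡ : ∀ n x f → x * ∑< n f ≈ ∑< n (λ k → x * f k)
  ∑<-*ˡ n x f = *-distribˡ-sum {n} x (f ∘ toℕ)

  ∑<-*ʳ : ∀ n x f → ∑< n f * x ≈ ∑< n (λ k → f k * x)
  ∑<-*ʳ n x f = *-distribʳ-sum {n} x (f ∘ toℕ)

  ∑<-split : ∀ m n f → ∑< (m ℕ.+ n) f ≈ ∑< m f + ∑< n (λ k → f (m ℕ.+ k))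
  ∑<-split zero    n f = sym (+-identityˡ _)
  ∑<-split (suc m) n f = trans (+-congˡ (∑<-split m n (f ∘ suc))) (sym (+-assoc _ _ _))

  ∑<-last : ∀ n f → ∑< (suc n) f ≈ ∑< n f + f n
  ∑<-last zero    f = +-comm _ _
  ∑<-last (suc n) f = trans (+-congˡ (∑<-last n (f ∘ suc))) (sym (+-assoc _ _ _))

module QShifted {c ℓ} (R : CommutativeRing c ℓ) where

  open CommutativeRing R hiding (zero)
  open SemiringExp semiring using (_^_)

  poch : Carrier → Carrier → ℕ → Carrier
  poch a b zero    = 1#
  poch a b (suc n) = poch a b n * (1# + - (a * b ^ n))

-- Gaussian binomials and q-differences

module QDifferences {c ℓ} (R : CommutativeRing c ℓ) (Q : CommutativeRing.Carrier R) where

  open CommutativeRing R hiding (zero)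
  open SetoidReasoning setoid
  open SemiringExp semiring using (_^_; ^-homo-*)
  open IntegerCoefficients R
  open Summation R
  open QShifted R

  -- Gaussian binomials by Pascal's rule, which makes sense before anything is known to be
  -- invertible.
  gauss : ℕ → ℕ → Carrier
  gauss m       zero    = 1#
  gauss zero    (suc r) = 0#
  gauss (suc m) (suc r) = gauss m r + Q ^ suc r * gauss m (suc r)

  -- The coefficient of Tᵏ in (T - Q)(T - Q²)⋯(T - Qⁿ).
  shiftCoeff : ℕ → ℕ → Carrier
  shiftCoeff zero    zero    = 1#
  shiftCoeff zero    (suc k) = 0#
  shiftCoeff (suc n) zero    = - (Q ^ suc n * shiftCoeff n 0)
  shiftCoeff (suc n) (suc k) = shiftCoeff n k - Q ^ suc n * shiftCoeff n (suc k)

  -- (-1)ⁱ Q^(i(i+1)/2)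
  signedPower : ℕ → Carrier
  signedPower zero    = 1#
  signedPower (suc i) = - (Q ^ suc i * signedPower i)

  [Q]_ : ℕ → Carrier
  [Q]_ = poch Q Q

  gauss-vanishes : ∀ m j → gauss m (suc (m ℕ.+ j)) ≈ 0#
  gauss-vanishes zero    j = refl
  gauss-vanishes (suc m) j = begin
    gauss m (suc (m ℕ.+ j)) + Q ^ suc (suc (m ℕ.+ j)) * gauss m (suc (suc (m ℕ.+ j)))
      ≈⟨ +-cong (gauss-vanishes m j)
           (*-congˡ (trans (reflexive (≡.cong (λ i → gauss m (suc i)) (≡.sym (ℕ.+-suc m j))))
                           (gauss-vanishes m (suc j)))) ⟩
    0# + Q ^ suc (suc (m ℕ.+ j)) * 0#  ≈⟨ +-congˡ (zeroʳ _) ⟩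
    0# + 0#                            ≈⟨ +-identityˡ _ ⟩
    0#                                 ∎

  gauss-< : ∀ {m r} → m < r → gauss m r ≈ 0#
  gauss-< {m} m<r with ℕ.m≤n⇒∃[o]m+o≡n m<r
  ... | j , ≡.refl = gauss-vanishes m j

  shiftCoeff-vanishes : ∀ n j → shiftCoeff n (suc (n ℕ.+ j)) ≈ 0#
  shiftCoeff-vanishes zero    j = refl
  shiftCoeff-vanishes (suc n) j = begin
    shiftCoeff n (suc (n ℕ.+ j)) - Q ^ suc n * shiftCoeff n (suc (suc (n ℕ.+ j)))
      ≈⟨ +-cong (shiftCoeff-vanishes n j)
           (-‿cong (*-congˡ (trans (reflexive (≡.cong (λ i → shiftCoeff n (suc i)) (≡.sym (ℕ.+-suc n j))))
                                   (shiftCoeff-vanishes n (suc j))))) ⟩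
    0# - Q ^ suc n * 0#  ≈⟨ solve 1 (λ x → con (0ℤ) :- x :* con 0ℤ := con 0ℤ) refl (Q ^ suc n) ⟩
    0#                   ∎

  shiftCoeff-< : ∀ {n k} → n < k → shiftCoeff n k ≈ 0#
  shiftCoeff-< {n} n<k with ℕ.m≤n⇒∃[o]m+o≡n n<k
  ... | j , ≡.refl = shiftCoeff-vanishes n j

  difference : ℕ → (ℕ → Carrier) → ℕ → Carrier
  difference n f m = ∑< (suc n) λ k → shiftCoeff n k * f (m ℕ.+ k)

  -- Splits off the factor T - Q^(n+1): the recursion of `shiftCoeff` is multiplication by that
  -- factor, and the sum is regrouped accordingly.
  difference-suc : ∀ n f m → difference (suc n) f m ≈
                   difference n (λ i → f (suc i) - Q ^ suc n * f i) m
  difference-suc n f m = begin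
    - (Q ^ suc n * e 0) * f (m ℕ.+ 0)
      + ∑< (suc n) (λ k → (e k - Q ^ suc n * e (suc k)) * f (m ℕ.+ suc k))
      ≈⟨ +-congˡ (∑<-cong (suc n) λ k _ →
           solve 4 (λ a b c d → (a :- b :* c) :* d := a :* d :+ (:- b) :* (c :* d)) refl
             (e k) (Q ^ suc n) (e (suc k)) (f (m ℕ.+ suc k))) ⟩
    - (Q ^ suc n * e 0) * f (m ℕ.+ 0) + ∑< (suc n) (λ k → up k + - (Q ^ suc n) * same (suc k))
      ≈⟨ +-congˡ (∑<-+ (suc n) up (λ k → - (Q ^ suc n) * same (suc k))) ⟩
    - (Q ^ suc n * e 0) * f (m ℕ.+ 0)
      + (∑< (suc n) up + ∑< (suc n) (λ k → - (Q ^ suc n) * same (suc k)))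
      ≈⟨ +-congˡ (+-congˡ (∑<-*ˡ (suc n) (- (Q ^ suc n)) (same ∘ suc))) ⟨
    - (Q ^ suc n * e 0) * f (m ℕ.+ 0) + (∑< (suc n) up + - (Q ^ suc n) * ∑< (suc n) (same ∘ suc))
      ≈⟨ solve 5 (λ a b c d s → (:- (a :* b)) :* c :+ (d :+ (:- a) :* s) :=
                                d :+ (:- a) :* (b :* c :+ s)) refl
           (Q ^ suc n) (e 0) (f (m ℕ.+ 0)) (∑< (suc n) up) (∑< (suc n) (same ∘ suc)) ⟩
    ∑< (suc n) up + - (Q ^ suc n) * ∑< (suc (suc n)) same
      ≈⟨ +-congˡ (*-congˡ (∑<-last (suc n) same)) ⟩
    ∑< (suc n) up + - (Q ^ suc n) * (∑< (suc n) same + same (suc n))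
      -- The extra top term has the coefficient `shiftCoeff n (suc n)`, which is zero.
      ≈⟨ +-congˡ (*-congˡ (trans
           (+-congˡ (trans (*-congʳ (shiftCoeff-< (ℕ.n<1+n n))) (zeroˡ _))) (+-identityʳ _))) ⟩
    ∑< (suc n) up + - (Q ^ suc n) * ∑< (suc n) same
      ≈⟨ +-congˡ (∑<-*ˡ (suc n) (- (Q ^ suc n)) same) ⟩
    ∑< (suc n) up + ∑< (suc n) (λ k → - (Q ^ suc n) * same k)
      ≈⟨ ∑<-+ (suc n) up (λ k → - (Q ^ suc n) * same k) ⟨
    ∑< (suc n) (λ k → up k + - (Q ^ suc n) * same k)
      ≈⟨ ∑<-cong (suc n) (λ k _ → trans
           (+-congʳ (*-congˡ (reflexive (≡.cong f (ℕ.+-suc m k)))))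
           (solve 4 (λ a b c d → a :* b :+ (:- c) :* (a :* d) := a :* (b :- c :* d)) refl
             (e k) (f (suc (m ℕ.+ k))) (Q ^ suc n) (f (m ℕ.+ k)))) ⟩
    difference n (λ i → f (suc i) - Q ^ suc n * f i) m ∎
    where
    e up same : ℕ → Carrier
    e = shiftCoeff n
    up k = e k * f (m ℕ.+ suc k)
    same k = e k * f (m ℕ.+ k)

  -- Pascal's rule says that T - Qⁿ lowers the index of the polynomial m ↦ gauss m n.
  difference-gauss : ∀ n m → difference n (λ i → gauss i n) m ≈ 1#
  difference-gauss zero    m = trans (+-identityʳ _) (*-identityˡ _)
  difference-gauss (suc n) m = begin
    difference (suc n) (λ i → gauss i (suc n)) m
      ≈⟨ difference-suc n (λ i → gauss i (suc n)) m ⟩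
    difference n (λ i → gauss (suc i) (suc n) - Q ^ suc n * gauss i (suc n)) m
      ≈⟨ ∑<-cong (suc n) (λ k _ → *-congˡ {shiftCoeff n k}
           (solve 2 (λ a b → a :+ b :- b := a) refl
             (gauss (m ℕ.+ k) n) (Q ^ suc n * gauss (m ℕ.+ k) (suc n)))) ⟩
    difference n (λ i → gauss i n) m
      ≈⟨ difference-gauss n m ⟩
    1# ∎

  gauss-diagonal : ∀ n → gauss n n ≈ 1#
  gauss-diagonal zero    = refl
  gauss-diagonal (suc n) = begin
    gauss n n + Q ^ suc n * gauss n (suc n)  ≈⟨ +-cong (gauss-diagonal n)
                                                  (*-congˡ (gauss-< (ℕ.n<1+n n))) ⟩
    1# + Q ^ suc n * 0#                      ≈⟨ +-congˡ (zeroʳ _) ⟩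
    1# + 0#                                  ≈⟨ +-identityʳ _ ⟩
    1#                                       ∎

  -- The quotient formula for Gaussian binomials, cleared of denominators. In the inductive step
  -- Pascal's rule meets (1 - u) + u(1 - w) = 1 - uw with u = Q^(r+1) and w = Q^(l+1).
  gauss-factorial : ∀ r l → gauss (r ℕ.+ l) r * ([Q] r * [Q] l) ≈ [Q] (r ℕ.+ l)
  gauss-factorial zero    l = trans (*-identityˡ _) (*-identityˡ _)
  gauss-factorial (suc r) zero = begin
    gauss (suc r ℕ.+ 0) (suc r) * ([Q] suc r * 1#)
      ≡⟨ ≡.cong (λ i → gauss (suc i) (suc r) * ([Q] suc r * 1#)) (ℕ.+-identityʳ r) ⟩
    gauss (suc r) (suc r) * ([Q] suc r * 1#)  ≈⟨ *-cong (gauss-diagonal (suc r)) (*-identityʳ _) ⟩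
    1# * [Q] suc r                            ≈⟨ *-identityˡ _ ⟩
    [Q] suc r                                 ≡⟨ ≡.cong (λ i → [Q] suc i) (ℕ.+-identityʳ r) ⟨
    [Q] (suc r ℕ.+ 0)                         ∎
  gauss-factorial (suc r) (suc l) = begin
    (gauss (r ℕ.+ suc l) r + Q ^ suc r * gauss (r ℕ.+ suc l) (suc r)) * ([Q] suc r * [Q] suc l)
      ≈⟨ solve 7 (λ g u g′ P u′ P′ w → (g :+ u :* g′) :* ((P :* u′) :* (P′ :* w)) :=
                   (g :* (P :* (P′ :* w))) :* u′ :+ u :* (g′ :* ((P :* u′) :* P′)) :* w) refl
           (gauss (r ℕ.+ suc l) r) (Q ^ suc r) (gauss (r ℕ.+ suc l) (suc r))
           ([Q] r) (1# - Q ^ suc r) ([Q] l) (1# - Q ^ suc l) ⟩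
    (gauss (r ℕ.+ suc l) r * ([Q] r * [Q] suc l)) * (1# - Q ^ suc r)
      + Q ^ suc r * (gauss (r ℕ.+ suc l) (suc r) * ([Q] suc r * [Q] l)) * (1# - Q ^ suc l)
      ≈⟨ +-cong (*-congʳ (gauss-factorial r (suc l)))
           (*-congʳ (*-congˡ (trans
             (reflexive (≡.cong (λ i → gauss i (suc r) * ([Q] suc r * [Q] l)) (ℕ.+-suc r l)))
             (trans (gauss-factorial (suc r) l) (reflexive (≡.cong [Q]_ (≡.sym (ℕ.+-suc r l)))))))) ⟩
    N * (1# - Q ^ suc r) + Q ^ suc r * N * (1# - Q ^ suc l)
      ≈⟨ solve 3 (λ N u w → N :* (con 1ℤ :- u) :+ u :* N :* (con 1ℤ :- w) :=
                            N :* (con 1ℤ :- u :* w)) refl N (Q ^ suc r) (Q ^ suc l) ⟩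
    N * (1# - Q ^ suc r * Q ^ suc l)
      ≈⟨ *-congˡ (+-congˡ (-‿cong (^-homo-* Q (suc r) (suc l)))) ⟨
    [Q] (suc r ℕ.+ suc l) ∎
    where
    N = [Q] (r ℕ.+ suc l)

  -- The q-binomial theorem: up to sign, the coefficient of Tᵏ in (T - Q)...(T - Q^(k+i)) is the
  -- i-th elementary symmetric polynomial of the roots, which is Q^(i(i+1)/2) times a Gaussian
  -- binomial.
  shiftCoeff-factorial : ∀ k i →
    shiftCoeff (k ℕ.+ i) k * ([Q] k * [Q] i) ≈ signedPower i * [Q] (k ℕ.+ i)
  shiftCoeff-factorial zero zero = solve 0 (con 1ℤ :* (con 1ℤ :* con 1ℤ) := con 1ℤ :* con 1ℤ) refl
  shiftCoeff-factorial zero (suc i) = begin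
    - (Q ^ suc i * shiftCoeff i 0) * (1# * ([Q] i * (1# - Q ^ suc i)))
      ≈⟨ solve 4 (λ w e P f → :- (w :* e) :* (con 1ℤ :* (P :* f)) :=
                              :- w :* (e :* (con 1ℤ :* P)) :* f) refl
           (Q ^ suc i) (shiftCoeff i 0) ([Q] i) (1# - Q ^ suc i) ⟩
    - (Q ^ suc i) * (shiftCoeff i 0 * (1# * [Q] i)) * (1# - Q ^ suc i)
      ≈⟨ *-congʳ (*-congˡ (shiftCoeff-factorial zero i)) ⟩
    - (Q ^ suc i) * (signedPower i * [Q] i) * (1# - Q ^ suc i)
      ≈⟨ solve 4 (λ w d P f → :- w :* (d :* P) :* f := :- (w :* d) :* (P :* f)) refl
           (Q ^ suc i) (signedPower i) ([Q] i) (1# - Q ^ suc i) ⟩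
    signedPower (suc i) * [Q] suc i ∎
  shiftCoeff-factorial (suc k) zero = begin
    (shiftCoeff (k ℕ.+ 0) k - Q ^ suc (k ℕ.+ 0) * shiftCoeff (k ℕ.+ 0) (suc k))
      * ([Q] k * (1# - Q ^ suc k) * 1#)
      ≈⟨ *-congʳ (+-congˡ (-‿cong (*-congˡ (shiftCoeff-< (s≤s (ℕ.≤-reflexive (ℕ.+-identityʳ k))))))) ⟩
    (shiftCoeff (k ℕ.+ 0) k - Q ^ suc (k ℕ.+ 0) * 0#) * ([Q] k * (1# - Q ^ suc k) * 1#)
      ≈⟨ solve 4 (λ e w P f → (e :- w :* con 0ℤ) :* (P :* f :* con 1ℤ) :=
                              e :* (P :* con 1ℤ) :* f) refl
           (shiftCoeff (k ℕ.+ 0) k) (Q ^ suc (k ℕ.+ 0)) ([Q] k) (1# - Q ^ suc k) ⟩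
    shiftCoeff (k ℕ.+ 0) k * ([Q] k * 1#) * (1# - Q ^ suc k)
      ≈⟨ *-cong (shiftCoeff-factorial k zero)
           (reflexive (≡.cong (λ j → 1# - Q ^ suc j) (≡.sym (ℕ.+-identityʳ k)))) ⟩
    1# * [Q] (k ℕ.+ 0) * (1# - Q ^ suc (k ℕ.+ 0))
      ≈⟨ *-assoc _ _ _ ⟩
    signedPower 0 * [Q] (suc k ℕ.+ 0) ∎
  shiftCoeff-factorial (suc k) (suc i) = begin
    (E₀ - Q ^ N * E₁) * ([Q] k * (1# - Q ^ suc k) * ([Q] i * (1# - Q ^ suc i)))
      ≈⟨ solve 7 (λ a w b P u P′ f →
           (a :- w :* b) :* (P :* u :* (P′ :* f)) :=
           (a :* (P :* (P′ :* f))) :* u :- w :* (b :* (P :* u :* P′)) :* f) refl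
           E₀ (Q ^ N) E₁ ([Q] k) (1# - Q ^ suc k) ([Q] i) (1# - Q ^ suc i) ⟩
    E₀ * ([Q] k * [Q] suc i) * (1# - Q ^ suc k)
      - Q ^ N * (E₁ * ([Q] suc k * [Q] i)) * (1# - Q ^ suc i)
      ≈⟨ +-cong (*-congʳ (shiftCoeff-factorial k (suc i)))
           (-‿cong (*-congʳ (*-congˡ (trans
             (reflexive (≡.cong (λ j → shiftCoeff j (suc k) * ([Q] suc k * [Q] i)) (ℕ.+-suc k i)))
             (trans (shiftCoeff-factorial (suc k) i)
                    (reflexive (≡.cong (λ j → signedPower i * [Q] j) (≡.sym (ℕ.+-suc k i))))))))) ⟩
    - (Q ^ suc i * signedPower i) * P * (1# - Q ^ suc k)
      - Q ^ N * (signedPower i * P) * (1# - Q ^ suc i)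
      ≈⟨ +-congˡ (-‿cong (*-congʳ (*-congʳ Qᴺ))) ⟩
    - (Q ^ suc i * signedPower i) * P * (1# - Q ^ suc k)
      - Q ^ suc k * Q ^ suc i * (signedPower i * P) * (1# - Q ^ suc i)
      ≈⟨ solve 4 (λ w d P u →
           :- (w :* d) :* P :* (con 1ℤ :- u) :- u :* w :* (d :* P) :* (con 1ℤ :- w) :=
           :- (w :* d) :* (P :* (con 1ℤ :- u :* w))) refl
           (Q ^ suc i) (signedPower i) P (Q ^ suc k) ⟩
    - (Q ^ suc i * signedPower i) * (P * (1# - Q ^ suc k * Q ^ suc i))
      ≈⟨ *-congˡ (*-congˡ (+-congˡ (-‿cong Qᴺ))) ⟨
    signedPower (suc i) * [Q] (suc k ℕ.+ suc i) ∎
    where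
    N = suc (k ℕ.+ suc i)
    P = [Q] (k ℕ.+ suc i)
    E₀ = shiftCoeff (k ℕ.+ suc i) k
    E₁ = shiftCoeff (k ℕ.+ suc i) (suc k)
    Qᴺ : Q ^ N ≈ Q ^ suc k * Q ^ suc i
    Qᴺ = ^-homo-* Q (suc k) (suc i)

-- Calculus to first order in ε

module FirstOrder {c ℓ} (R : CommutativeRing c ℓ) (ε : CommutativeRing.Carrier R) where

  open CommutativeRing R hiding (zero)
  open SemiringExp semiring using (_^_)
  open IntegerCoefficients R
  open QShifted R

  infix 4 _∣_around_

  -- A pair conjugate under ε ↦ -ε. The slope is stored because it cannot be recovered from `a` and
  -- `b` once ε is nilpotent.
  record _∣_around_ (a b v : Carrier) : Set (c ⊔ ℓ) where
    field
      slope : Carrier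
      a≈    : a ≈ v + ε * slope
      b≈    : b ≈ v - ε * slope

  open _∣_around_

  -- Allows a factor moved by +ε to be multiplied by one moved by -ε; `around-*` combines only
  -- factors moved the same way.
  around-swap : ∀ {a b v} → a ∣ b around v → b ∣ a around v
  around-swap {v = v} A = record
    { slope = - slope A
    ; a≈ = trans (b≈ A) (solve 3 (λ v e s → v :- e :* s := v :+ e :* (:- s)) refl v ε (slope A))
    ; b≈ = trans (a≈ A) (solve 3 (λ v e s → v :+ e :* s := v :- e :* (:- s)) refl v ε (slope A))
    }

  around-sum : ∀ {a b v} → a ∣ b around v → a + b ≈ v + v
  around-sum {v = v} A = trans (+-cong (a≈ A) (b≈ A))
    (solve 2 (λ v t → v :+ t :+ (v :- t) := v :+ v) refl v (ε * slope A))

  module _ (ε²≈0 : ε * ε ≈ 0#) where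

    around-* : ∀ {a b v a′ b′ v′} → a ∣ b around v → a′ ∣ b′ around v′ →
               a * a′ ∣ b * b′ around v * v′
    around-* {v = v} {v′ = v′} A A′ = record
      { slope = v * s′ + s * v′
      ; a≈ = trans (*-cong (a≈ A) (a≈ A′)) (trans
               (solve 5 (λ v v′ s s′ e → (v :+ e :* s) :* (v′ :+ e :* s′) :=
                  v :* v′ :+ e :* (v :* s′ :+ s :* v′) :+ (e :* e) :* (s :* s′)) refl v v′ s s′ ε)
               drop)
      ; b≈ = trans (*-cong (b≈ A) (b≈ A′)) (trans
               (solve 5 (λ v v′ s s′ e → (v :- e :* s) :* (v′ :- e :* s′) :=
                  v :* v′ :- e :* (v :* s′ :+ s :* v′) :+ (e :* e) :* (s :* s′)) refl v v′ s s′ ε)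
               drop)
      }
      where
      s  = slope A
      s′ = slope A′
      drop : ∀ {x} → x + (ε * ε) * (s * s′) ≈ x
      drop = trans (+-congˡ (trans (*-congʳ ε²≈0) (zeroˡ _))) (+-identityʳ _)

    around-poch : ∀ a b k →
      poch (a * (1# + ε)) b k ∣ poch (a * (1# - ε)) b k around poch a b k
    around-poch a b zero    = record
      { slope = 0#
      ; a≈ = solve 1 (λ e → con 1ℤ := con 1ℤ :+ e :* con 0ℤ) refl ε
      ; b≈ = solve 1 (λ e → con 1ℤ := con 1ℤ :- e :* con 0ℤ) refl ε
      }
    around-poch a b (suc k) = around-* (around-poch a b k) record
      { slope = - (a * b ^ k)
      ; a≈ = solve 3 (λ a x e → con 1ℤ :+ :- (a :* (con 1ℤ :+ e) :* x) :=
                      con 1ℤ :+ :- (a :* x) :+ e :* (:- (a :* x))) refl a (b ^ k) ε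
      ; b≈ = solve 3 (λ a x e → con 1ℤ :+ :- (a :* (con 1ℤ :- e) :* x) :=
                      con 1ℤ :+ :- (a :* x) :- e :* (:- (a :* x))) refl a (b ^ k) ε
      }

-- The two terminating sums in a ring with ε² = 0

module TerminatingSum {c ℓ} (R : CommutativeRing c ℓ)
  (q Q : CommutativeRing.Carrier R)
  (Q≈q² : CommutativeRing._≈_ R Q (SemiringExp._^_ (CommutativeRing.semiring R) q 2))
  (n : ℕ) where

  open CommutativeRing R hiding (zero)
  open SetoidReasoning setoid
  open SemiringExp semiring using (_^_; ^-homo-*; ^-assocʳ; ^-congˡ)
  open IntegerCoefficients R
  open Summation R
  open QShifted R
  open QDifferences R Q

  ε y z : Carrier
  ε = 1# - q ^ suc (2 ℕ.* n)
  y = q * (1# + ε)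
  z = q * (1# - ε)

  open FirstOrder R ε

  Qᵏ≈q²ᵏ : ∀ k → Q ^ k ≈ q ^ (2 ℕ.* k)
  Qᵏ≈q²ᵏ k = trans (^-congˡ k Q≈q²) (^-assocʳ q 2 k)

  1-ε : 1# - ε ≈ q ^ suc (2 ℕ.* n)
  1-ε = solve 1 (λ x → con 1ℤ :- (con 1ℤ :- x) := x) refl (q ^ suc (2 ℕ.* n))

  z≈Qⁿ⁺¹ : z ≈ Q ^ suc n
  z≈Qⁿ⁺¹ = begin
    q * (1# - ε)             ≈⟨ *-congˡ 1-ε ⟩
    q ^ suc (suc (2 ℕ.* n))  ≡⟨ ≡.cong (q ^_) (ℕ.*-suc 2 n) ⟨
    q ^ (2 ℕ.* suc n)        ≈⟨ Qᵏ≈q²ᵏ (suc n) ⟨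
    Q ^ suc n                ∎

  -- (Q^(n+1);Q)_l consists of the factors that follow those of (Q;Q)_n.
  poch-Qⁿ⁺¹ : ∀ l → [Q] n * poch (Q ^ suc n) Q l ≈ [Q] (n ℕ.+ l)
  poch-Qⁿ⁺¹ zero    = trans (*-identityʳ _) (reflexive (≡.cong [Q]_ (≡.sym (ℕ.+-identityʳ n))))
  poch-Qⁿ⁺¹ (suc l) = begin
    [Q] n * (poch (Q ^ suc n) Q l * (1# - Q ^ suc n * Q ^ l))  ≈⟨ *-assoc _ _ _ ⟨
    [Q] n * poch (Q ^ suc n) Q l * (1# - Q ^ suc n * Q ^ l)
      ≈⟨ *-cong (poch-Qⁿ⁺¹ l) (+-congˡ (-‿cong (sym (^-homo-* Q (suc n) l)))) ⟩
    [Q] suc (n ℕ.+ l)                                          ≡⟨ ≡.cong [Q]_ (ℕ.+-suc n l) ⟨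
    [Q] (n ℕ.+ suc l)                                          ∎

  poch-congˡ : ∀ {a a′} b k → a ≈ a′ → poch a b k ≈ poch a′ b k
  poch-congˡ b zero    a≈a′ = refl
  poch-congˡ b (suc k) a≈a′ =
    *-cong (poch-congˡ b k a≈a′) (+-congˡ (-‿cong (*-congʳ a≈a′)))

  module _
    (ε²≈0 : ε * ε ≈ 0#)
    ([Q]⁻¹ : ∀ k → k ≤ 2 ℕ.* n → ∃[ u ] u * [Q] k ≈ 1#)
    where

    -- Division by (Q;Q)_k. The bound 2n is p - 1: it covers k + s for k, s ≤ n, and the next factor
    -- 1 - Q^p would be a multiple of [p].
    cancel : ∀ k → k ≤ 2 ℕ.* n → ∀ {a b} → a * [Q] k ≈ b * [Q] k → a ≈ b
    cancel k k≤2n {a} {b} aP≈bP with [Q]⁻¹ k k≤2n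
    ... | u , uP≈1 = begin
      a                ≈⟨ expand a ⟩
      a * [Q] k * u    ≈⟨ *-congʳ aP≈bP ⟩
      b * [Q] k * u    ≈⟨ expand b ⟨
      b                ∎
      where
      expand : ∀ x → x ≈ x * [Q] k * u
      expand x = begin
        x                ≈⟨ *-identityʳ x ⟨
        x * 1#           ≈⟨ *-congˡ uP≈1 ⟨
        x * (u * [Q] k)  ≈⟨ solve 3 (λ x u P → x :* (u :* P) := x :* P :* u) refl x u ([Q] k) ⟩
        x * [Q] k * u    ∎

    n≤2n : n ≤ 2 ℕ.* n
    n≤2n = ℕ.m≤m+n n _

    -- Divided by (Q;Q)_l, the product (Q^(n+1);Q)_l is (Q;Q)_(n+l) / ((Q;Q)_n (Q;Q)_l), a Gaussian
    -- binomial.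
    poch-z : ∀ l → poch z Q l ≈ gauss (n ℕ.+ l) n * [Q] l
    poch-z l = cancel n n≤2n (begin
      poch z Q l * [Q] n                   ≈⟨ *-comm _ _ ⟩
      [Q] n * poch z Q l                   ≈⟨ *-congˡ (poch-congˡ Q l z≈Qⁿ⁺¹) ⟩
      [Q] n * poch (Q ^ suc n) Q l         ≈⟨ poch-Qⁿ⁺¹ l ⟩
      [Q] (n ℕ.+ l)                        ≈⟨ gauss-factorial n l ⟨
      gauss (n ℕ.+ l) n * ([Q] n * [Q] l)
        ≈⟨ solve 3 (λ g N L → g :* (N :* L) := g :* L :* N) refl _ ([Q] n) ([Q] l) ⟩
      gauss (n ℕ.+ l) n * [Q] l * [Q] n    ∎)

    -- Since q^(2n+1) = 1 - ε, the product is (1 + ε)(1 - ε) = 1 - ε².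
    yQⁿ≈1 : y * Q ^ n ≈ 1#
    yQⁿ≈1 = begin
      q * (1# + ε) * Q ^ n               ≈⟨ *-congˡ (Qᵏ≈q²ᵏ n) ⟩
      q * (1# + ε) * q ^ (2 ℕ.* n)
        ≈⟨ solve 3 (λ q e x → q :* e :* x := e :* (q :* x)) refl q (1# + ε) (q ^ (2 ℕ.* n)) ⟩
      (1# + ε) * q ^ suc (2 ℕ.* n)       ≈⟨ *-congˡ 1-ε ⟨
      (1# + ε) * (1# - ε)
        ≈⟨ solve 1 (λ e → (con 1ℤ :+ e) :* (con 1ℤ :- e) := con 1ℤ :- e :* e) refl ε ⟩
      1# - ε * ε                         ≈⟨ +-congˡ (-‿cong ε²≈0) ⟩
      1# - 0#                            ≈⟨ solve 0 (con 1ℤ :- con 0ℤ := con 1ℤ) refl ⟩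
      1#                                 ∎

    poch-y-vanishes : ∀ j → poch y Q (suc (n ℕ.+ j)) ≈ 0#
    poch-y-vanishes zero = begin
      poch y Q (suc (n ℕ.+ 0))           ≡⟨ ≡.cong (poch y Q ∘ suc) (ℕ.+-identityʳ n) ⟩
      poch y Q n * (1# - y * Q ^ n)      ≈⟨ *-congˡ (+-congˡ (-‿cong yQⁿ≈1)) ⟩
      poch y Q n * (1# - 1#)             ≈⟨ *-congˡ (-‿inverseʳ 1#) ⟩
      poch y Q n * 0#                    ≈⟨ zeroʳ _ ⟩
      0#                                 ∎
    poch-y-vanishes (suc j) = begin
      poch y Q (suc (n ℕ.+ suc j))       ≡⟨ ≡.cong (poch y Q ∘ suc) (ℕ.+-suc n j) ⟩
      poch y Q (suc (suc (n ℕ.+ j)))     ≈⟨ *-congʳ (poch-y-vanishes j) ⟩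
      0# * _                             ≈⟨ zeroˡ _ ⟩
      0#                                 ∎

    -- Turns the factors of (y;Q)_k around: 1 - Q^(-j) = -Q^(-j) (1 - Q^j) for i < j ≤ n. The signs
    -- and powers multiply to `signedPower i` over `signedPower n`, the remaining factors to (Q;Q)_n
    -- over (Q;Q)_i.
    poch-y-signed : ∀ k i → k ℕ.+ i ≡ n →
                    poch y Q k * [Q] i * signedPower n ≈ signedPower i * [Q] n
    poch-y-signed zero    i ≡.refl = solve 2 (λ P d → con 1ℤ :* P :* d := d :* P) refl _ _
    poch-y-signed (suc k) i eq = begin
      poch y Q k * (1# - u) * [Q] i * signedPower n
        -- With w = Q^(i+1) one has 1 - u = -u(1 - w) + (1 - uw), and uw = 1 removes the last
        -- summand.
        ≈⟨ solve 5 (λ Y u P d w → Y :* (con 1ℤ :- u) :* P :* d :=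
              (:- u) :* (Y :* (P :* (con 1ℤ :- w)) :* d) :+ (con 1ℤ :- u :* w) :* (Y :* P :* d))
             refl (poch y Q k) u ([Q] i) (signedPower n) (Q ^ suc i) ⟩
      - u * (poch y Q k * [Q] suc i * signedPower n) + (1# - u * Q ^ suc i) * rest
        ≈⟨ +-cong (*-congˡ (poch-y-signed k (suc i) (≡.trans (ℕ.+-suc k i) eq)))
                  (*-congʳ (+-congˡ (-‿cong uw≈1))) ⟩
      - u * (- (Q ^ suc i * signedPower i) * [Q] n) + (1# - 1#) * rest
        ≈⟨ solve 5 (λ u w d N r → (:- u) :* (:- (w :* d) :* N) :+ (con 1ℤ :- con 1ℤ) :* r :=
              (u :* w) :* (d :* N)) refl u (Q ^ suc i) (signedPower i) ([Q] n) rest ⟩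
      u * Q ^ suc i * (signedPower i * [Q] n)  ≈⟨ *-congʳ uw≈1 ⟩
      1# * (signedPower i * [Q] n)             ≈⟨ *-identityˡ _ ⟩
      signedPower i * [Q] n                    ∎
      where
      u rest : Carrier
      u = y * Q ^ k
      rest = poch y Q k * [Q] i * signedPower n
      uw≈1 : u * Q ^ suc i ≈ 1#
      uw≈1 = begin
        y * Q ^ k * Q ^ suc i    ≈⟨ *-assoc _ _ _ ⟩
        y * (Q ^ k * Q ^ suc i)  ≈⟨ *-congˡ (^-homo-* Q k (suc i)) ⟨
        y * Q ^ (k ℕ.+ suc i)    ≡⟨ ≡.cong (λ j → y * Q ^ j) (≡.trans (ℕ.+-suc k i) eq) ⟩
        y * Q ^ n                ≈⟨ yQⁿ≈1 ⟩
        1#                       ∎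

    -- After multiplication by `signedPower n`, the quotient (y;Q)_k / (Q;Q)_k is a coefficient of
    -- the q-difference operator. Indices above n are included because k + s can exceed n; there
    -- both sides vanish.
    poch-y : ∀ k → poch y Q k * signedPower n ≈ shiftCoeff n k * [Q] k
    poch-y k with k ℕ.≤? n
    ... | yes k≤n with ℕ.m≤n⇒∃[o]m+o≡n k≤n
    ...   | i , k+i≡n = cancel i (ℕ.≤-trans i≤n n≤2n) (begin
      poch y Q k * signedPower n * [Q] i     ≈⟨ solve 3 (λ a b c → a :* b :* c := a :* c :* b) refl _ _ _ ⟩
      poch y Q k * [Q] i * signedPower n     ≈⟨ poch-y-signed k i k+i≡n ⟩
      signedPower i * [Q] n                  ≡⟨ ≡.cong (λ j → signedPower i * [Q] j) k+i≡n ⟨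
      signedPower i * [Q] (k ℕ.+ i)          ≈⟨ shiftCoeff-factorial k i ⟨
      shiftCoeff (k ℕ.+ i) k * ([Q] k * [Q] i)
        ≡⟨ ≡.cong (λ j → shiftCoeff j k * ([Q] k * [Q] i)) k+i≡n ⟩
      shiftCoeff n k * ([Q] k * [Q] i)       ≈⟨ *-assoc _ _ _ ⟨
      shiftCoeff n k * [Q] k * [Q] i         ∎)
      where
      i≤n : i ≤ n
      i≤n = ≡.subst (i ≤_) k+i≡n (ℕ.m≤n+m i k)
    poch-y k | no k≰n with ℕ.m≤n⇒∃[o]m+o≡n (ℕ.≰⇒> k≰n)
    ...   | j , ≡.refl = begin
      poch y Q (suc (n ℕ.+ j)) * signedPower n       ≈⟨ *-congʳ (poch-y-vanishes j) ⟩
      0# * signedPower n                             ≈⟨ zeroˡ _ ⟩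
      0#                                             ≈⟨ zeroˡ _ ⟨
      0# * [Q] suc (n ℕ.+ j)                         ≈⟨ *-congʳ (shiftCoeff-vanishes n j) ⟨
      shiftCoeff n (suc (n ℕ.+ j)) * [Q] suc (n ℕ.+ j) ∎

    module _ (s : ℕ) (s≤n : s ≤ n) where

      e g : ℕ → Carrier
      e = shiftCoeff n
      g m = gauss m n

      sum-unshifted : ∑< (suc n) (λ k → e k * g (n ℕ.+ (k ℕ.+ s))) ≈ 1#
      sum-unshifted = trans
        (∑<-cong (suc n) {λ k → e k * g (n ℕ.+ (k ℕ.+ s))} {λ k → e k * g (n ℕ.+ s ℕ.+ k)}
          (λ k _ → *-congˡ (reflexive (≡.cong g
            (≡.trans (≡.cong (n ℕ.+_) (ℕ.+-comm k s)) (≡.sym (ℕ.+-assoc n s k)))))))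
        (difference-gauss n (n ℕ.+ s))

      -- With l = k + s this is the q-difference at n - s, except that l runs from s to n + s and
      -- not from 0 to n. The two ends make no difference: for l < s the Gaussian binomial has its
      -- upper index below n, and for l > n the coefficient is zero.
      sum-shifted : ∑< (suc n) (λ k → e (k ℕ.+ s) * g (n ℕ.+ k)) ≈ 1#
      sum-shifted = begin
        ∑< (suc n) (λ k → e (k ℕ.+ s) * g (n ℕ.+ k))
          ≈⟨ ∑<-cong (suc n) {λ k → e (k ℕ.+ s) * g (n ℕ.+ k)} {λ k → F (s ℕ.+ k)}
               (λ k _ → reflexive (≡.cong₂ (λ a b → e a * g b) (ℕ.+-comm k s) (index k))) ⟩
        ∑< (suc n) (λ k → F (s ℕ.+ k))
          ≈⟨ trans (+-congʳ low) (+-identityˡ _) ⟨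
        ∑< s F + ∑< (suc n) (λ k → F (s ℕ.+ k))
          ≈⟨ ∑<-split s (suc n) F ⟨
        ∑< (s ℕ.+ suc n) F
          ≡⟨ ≡.cong (λ m → ∑< m F) (ℕ.+-comm s (suc n)) ⟩
        ∑< (suc n ℕ.+ s) F
          ≈⟨ ∑<-split (suc n) s F ⟩
        ∑< (suc n) F + ∑< s (λ k → F (suc n ℕ.+ k))
          ≈⟨ trans (+-congˡ high) (+-identityʳ _) ⟩
        ∑< (suc n) F
          ≈⟨ difference-gauss n (n ∸ s) ⟩
        1# ∎
        where
        F : ℕ → Carrier
        F l = e l * g (n ∸ s ℕ.+ l)
        index : ∀ k → n ℕ.+ k ≡ n ∸ s ℕ.+ (s ℕ.+ k)
        index k = ≡.trans (≡.cong (ℕ._+ k) (≡.sym (ℕ.m∸n+n≡m s≤n))) (ℕ.+-assoc (n ∸ s) s k)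
        low : ∑< s F ≈ 0#
        low = ∑<-zero s {F} λ k k<s → trans
          (*-congˡ (gauss-< (≡.subst (n ∸ s ℕ.+ k <_) (ℕ.m∸n+n≡m s≤n) (ℕ.+-monoʳ-< (n ∸ s) k<s))))
          (zeroʳ _)
        high : ∑< s (λ k → F (suc n ℕ.+ k)) ≈ 0#
        high = ∑<-zero s {λ k → F (suc n ℕ.+ k)} λ k _ →
          trans (*-congʳ (shiftCoeff-vanishes n k)) (zeroˡ _)

      -- The factor of index k is moved by +ε and that of index k + s by -ε, then conversely; the
      -- linear terms cancel and twice the product at q remains.
      doubled-term : ∀ k → poch q Q k * poch q Q (k ℕ.+ s) * signedPower n
                         + poch q Q k * poch q Q (k ℕ.+ s) * signedPower n ≈
        (e k * g (n ℕ.+ (k ℕ.+ s)) + e (k ℕ.+ s) * g (n ℕ.+ k)) * ([Q] k * [Q] (k ℕ.+ s))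
      doubled-term k = begin
        v * d + v * d
          ≈⟨ distribʳ d v v ⟨
        (v + v) * d
          ≈⟨ *-congʳ (around-sum (around-* ε²≈0 (around-poch ε²≈0 q Q k)
                                   (around-swap (around-poch ε²≈0 q Q (k ℕ.+ s))))) ⟨
        (Y k * Z (k ℕ.+ s) + Z k * Y (k ℕ.+ s)) * d
          ≈⟨ solve 5 (λ a b c f d → (a :* b :+ c :* f) :* d := a :* d :* b :+ f :* d :* c) refl
               (Y k) (Z (k ℕ.+ s)) (Z k) (Y (k ℕ.+ s)) d ⟩
        Y k * d * Z (k ℕ.+ s) + Y (k ℕ.+ s) * d * Z k
          ≈⟨ +-cong (*-cong (poch-y k) (poch-z (k ℕ.+ s))) (*-cong (poch-y (k ℕ.+ s)) (poch-z k)) ⟩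
        e k * [Q] k * (g (n ℕ.+ (k ℕ.+ s)) * [Q] (k ℕ.+ s))
          + e (k ℕ.+ s) * [Q] (k ℕ.+ s) * (g (n ℕ.+ k) * [Q] k)
          ≈⟨ solve 6 (λ a P b P′ c f → a :* P :* (b :* P′) :+ c :* P′ :* (f :* P) :=
                       (a :* b :+ c :* f) :* (P :* P′)) refl
               (e k) ([Q] k) (g (n ℕ.+ (k ℕ.+ s))) ([Q] (k ℕ.+ s)) (e (k ℕ.+ s)) (g (n ℕ.+ k)) ⟩
        (e k * g (n ℕ.+ (k ℕ.+ s)) + e (k ℕ.+ s) * g (n ℕ.+ k)) * ([Q] k * [Q] (k ℕ.+ s)) ∎
        where
        Y Z : ℕ → Carrier
        Y = poch y Q
        Z = poch z Q
        d v : Carrier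
        d = signedPower n
        v = poch q Q k * poch q Q (k ℕ.+ s)

      -- The ring has no division, so the summands enter as any `x` that satisfies the equation
      -- defining the quotient.
      doubled-sum : (x : ℕ → Carrier) →
        (∀ k → k ≤ n → x k * ([Q] k * [Q] (k ℕ.+ s)) ≈ poch q Q k * poch q Q (k ℕ.+ s)) →
        ∑< (suc n) x * signedPower n + ∑< (suc n) x * signedPower n ≈ 1# + 1#
      doubled-sum x x≈ = begin
        ∑< (suc n) x * d + ∑< (suc n) x * d
          ≈⟨ distribˡ (∑< (suc n) x) d d ⟨
        ∑< (suc n) x * (d + d)
          ≈⟨ ∑<-*ʳ (suc n) (d + d) x ⟩
        ∑< (suc n) (λ k → x k * (d + d))
          ≈⟨ ∑<-cong (suc n) {λ k → x k * (d + d)} {λ k → A k + B k}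
               (λ { k (s≤s k≤n) → term k k≤n }) ⟩
        ∑< (suc n) (λ k → A k + B k)
          ≈⟨ ∑<-+ (suc n) A B ⟩
        ∑< (suc n) A + ∑< (suc n) B
          ≈⟨ +-cong sum-unshifted sum-shifted ⟩
        1# + 1# ∎
        where
        d : Carrier
        d = signedPower n
        A B : ℕ → Carrier
        A k = e k * g (n ℕ.+ (k ℕ.+ s))
        B k = e (k ℕ.+ s) * g (n ℕ.+ k)
        term : ∀ k → k ≤ n → x k * (d + d) ≈ A k + B k
        term k k≤n = cancel k (ℕ.≤-trans k≤n n≤2n) (cancel (k ℕ.+ s) k+s≤2n (begin
          x k * (d + d) * [Q] k * [Q] (k ℕ.+ s)
            ≈⟨ solve 4 (λ x d P P′ → x :* (d :+ d) :* P :* P′ :=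
                         x :* (P :* P′) :* d :+ x :* (P :* P′) :* d) refl
                 (x k) d ([Q] k) ([Q] (k ℕ.+ s)) ⟩
          x k * ([Q] k * [Q] (k ℕ.+ s)) * d + x k * ([Q] k * [Q] (k ℕ.+ s)) * d
            ≈⟨ +-cong (*-congʳ (x≈ k k≤n)) (*-congʳ (x≈ k k≤n)) ⟩
          poch q Q k * poch q Q (k ℕ.+ s) * d + poch q Q k * poch q Q (k ℕ.+ s) * d
            ≈⟨ doubled-term k ⟩
          (A k + B k) * ([Q] k * [Q] (k ℕ.+ s))
            ≈⟨ *-assoc _ _ _ ⟨
          (A k + B k) * [Q] k * [Q] (k ℕ.+ s) ∎))
          where
          k+s≤2n : k ℕ.+ s ≤ 2 ℕ.* n
          k+s≤2n = ≡.subst (k ℕ.+ s ≤_) (≡.cong (n ℕ.+_) (≡.sym (ℕ.+-identityʳ n)))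
                     (ℕ.+-mono-≤ k≤n s≤n)

-- Convolution of coefficient sequences

module Convolution {c ℓ} (R : CommutativeRing c ℓ) where

  open CommutativeRing R hiding (zero)
  open SetoidReasoning setoid
  open IntegerCoefficients R

  -- The Cauchy product. Through it the laws of polynomial multiplication are proved for coefficient
  -- functions, where the lengths of lists do not matter.
  conv : (ℕ → Carrier) → (ℕ → Carrier) → ℕ → Carrier
  conv f g zero    = f 0 * g 0
  conv f g (suc n) = f 0 * g (suc n) + conv (f ∘ suc) g n

  conv-cong : ∀ {f f′ g g′} → (∀ n → f n ≈ f′ n) → (∀ n → g n ≈ g′ n) →
              ∀ n → conv f g n ≈ conv f′ g′ n
  conv-cong f≈ g≈ zero    = *-cong (f≈ 0) (g≈ 0)
  conv-cong f≈ g≈ (suc n) = +-cong (*-cong (f≈ 0) (g≈ (suc n))) (conv-cong (f≈ ∘ suc) g≈ n)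

  conv-zeroˡ : ∀ g n → conv (λ _ → 0#) g n ≈ 0#
  conv-zeroˡ g zero    = zeroˡ _
  conv-zeroˡ g (suc n) = trans (+-cong (zeroˡ _) (conv-zeroˡ g n)) (+-identityˡ 0#)

  conv-distribʳ : ∀ h f g n → conv (λ i → f i + g i) h n ≈ conv f h n + conv g h n
  conv-distribʳ h f g zero    = distribʳ _ _ _
  conv-distribʳ h f g (suc n) = trans (+-congˡ (conv-distribʳ h (f ∘ suc) (g ∘ suc) n))
    (solve 5 (λ a b c x y → (a :+ b) :* c :+ (x :+ y) := a :* c :+ x :+ (b :* c :+ y)) refl
      (f 0) (g 0) (h (suc n)) (conv (f ∘ suc) h n) (conv (g ∘ suc) h n))

  conv-scaleˡ : ∀ a f g n → conv (λ i → a * f i) g n ≈ a * conv f g n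
  conv-scaleˡ a f g zero    = *-assoc _ _ _
  conv-scaleˡ a f g (suc n) = trans (+-congˡ (conv-scaleˡ a (f ∘ suc) g n))
    (solve 4 (λ a x y z → a :* x :* y :+ a :* z := a :* (x :* y :+ z)) refl
      a (f 0) (g (suc n)) (conv (f ∘ suc) g n))

  -- The definition peels off the first summand and this the last; commutativity needs both ends.
  conv-sucʳ : ∀ f g n → conv f g (suc n) ≈ conv f (g ∘ suc) n + f (suc n) * g 0
  conv-sucʳ f g zero    = refl
  conv-sucʳ f g (suc n) = trans (+-congˡ (conv-sucʳ (f ∘ suc) g n)) (sym (+-assoc _ _ _))

  conv-comm : ∀ f g n → conv f g n ≈ conv g f n
  conv-comm f g zero    = *-comm _ _
  conv-comm f g (suc n) = begin
    f 0 * g (suc n) + conv (f ∘ suc) g n    ≈⟨ +-comm _ _ ⟩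
    conv (f ∘ suc) g n + f 0 * g (suc n)    ≈⟨ +-cong (conv-comm (f ∘ suc) g n) (*-comm _ _) ⟩
    conv g (f ∘ suc) n + g (suc n) * f 0    ≈⟨ conv-sucʳ g f n ⟨
    conv g f (suc n)                        ∎

  conv-assoc : ∀ f g h n → conv (conv f g) h n ≈ conv f (conv g h) n
  conv-assoc f g h zero    = *-assoc _ _ _
  conv-assoc f g h (suc n) = begin
    f 0 * g 0 * h (suc n) + conv (λ i → f 0 * g (suc i) + conv (f ∘ suc) g i) h n
      ≈⟨ +-congˡ (conv-distribʳ h (λ i → f 0 * g (suc i)) (conv (f ∘ suc) g) n) ⟩
    f 0 * g 0 * h (suc n) + (conv (λ i → f 0 * g (suc i)) h n + conv (conv (f ∘ suc) g) h n)
      ≈⟨ +-congˡ (+-cong (conv-scaleˡ (f 0) (g ∘ suc) h n) (conv-assoc (f ∘ suc) g h n)) ⟩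
    f 0 * g 0 * h (suc n) + (f 0 * conv (g ∘ suc) h n + conv (f ∘ suc) (conv g h) n)
      ≈⟨ solve 5 (λ a b c x y → a :* b :* c :+ (a :* x :+ y) := a :* (b :* c :+ x) :+ y) refl
           (f 0) (g 0) (h (suc n)) (conv (g ∘ suc) h n) (conv (f ∘ suc) (conv g h) n) ⟩
    conv f (conv g h) (suc n) ∎

-- Quotients of a commutative ring and their units

module QuotientRing {c ℓ} (R : CommutativeRing c ℓ) (m : CommutativeRing.Carrier R) where

  open CommutativeRing R hiding (zero)
  open SetoidReasoning setoid
  open IntegerCoefficients R

  infix 4 _≈ₘ_

  -- The quotient keeps the carrier and only coarsens equality, so one and the same element can be
  -- studied modulo w and modulo w².
  record _≈ₘ_ (a b : Carrier) : Set (c ⊔ ℓ) where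
    constructor _,_
    field
      multiple : Carrier
      equality : a ≈ b + multiple * m

  fromEq : ∀ {a b} → a ≈ b → a ≈ₘ b
  fromEq {a} {b} a≈b = 0# , trans a≈b (solve 2 (λ b m → b := b :+ con 0ℤ :* m) refl b m)

  quotientRing : CommutativeRing c (c ⊔ ℓ)
  quotientRing = record
    { Carrier = Carrier ; _≈_ = _≈ₘ_ ; _+_ = _+_ ; _*_ = _*_ ; -_ = -_ ; 0# = 0# ; 1# = 1#
    ; isCommutativeRing = record
      { isRing = record
        { +-isAbelianGroup = record
          { isGroup = record
            { isMonoid = record
              { isSemigroup = record
                { isMagma = record
                  { isEquivalence = record
                    { refl = fromEq refl
                    ; sym = λ { {a} {b} (u , e) → - u , (begin
                        b                    ≈⟨ solve 3 (λ b u m → b := b :+ u :* m :+ (:- u) :* m) refl b u m ⟩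
                        b + u * m + - u * m  ≈⟨ +-congʳ e ⟨
                        a + - u * m          ∎) }
                    ; trans = λ { {a} {b} {d} (u , e) (v , f) → v + u , (begin
                        a                    ≈⟨ e ⟩
                        b + u * m            ≈⟨ +-congʳ f ⟩
                        d + v * m + u * m    ≈⟨ solve 4 (λ d v u m → d :+ v :* m :+ u :* m :=
                                                   d :+ (v :+ u) :* m) refl d v u m ⟩
                        d + (v + u) * m      ∎) }
                    }
                  ; ∙-cong = λ { {a} {a′} {b} {b′} (u , e) (v , f) → u + v , (begin
                      a + b                            ≈⟨ +-cong e f ⟩
                      a′ + u * m + (b′ + v * m)        ≈⟨ solve 5 (λ a b u v m →
                         a :+ u :* m :+ (b :+ v :* m) := a :+ b :+ (u :+ v) :* m) refl a′ b′ u v m ⟩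
                      a′ + b′ + (u + v) * m            ∎) }
                  }
                ; assoc = λ a b d → fromEq (+-assoc a b d)
                }
              ; identity = (λ a → fromEq (+-identityˡ a)) , (λ a → fromEq (+-identityʳ a))
              }
            ; inverse = (λ a → fromEq (-‿inverseˡ a)) , (λ a → fromEq (-‿inverseʳ a))
            ; ⁻¹-cong = λ { {a} {b} (u , e) → - u , trans (-‿cong e)
                (solve 3 (λ b u m → :- (b :+ u :* m) := :- b :+ (:- u) :* m) refl b u m) }
            }
          ; comm = λ a b → fromEq (+-comm a b)
          }
        ; *-cong = λ { {a} {a′} {b} {b′} (u , e) (v , f) → u * b′ + a′ * v + u * v * m , (begin
            a * b                              ≈⟨ *-cong e f ⟩
            (a′ + u * m) * (b′ + v * m)        ≈⟨ solve 5 (λ a b u v m →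
               (a :+ u :* m) :* (b :+ v :* m) := a :* b :+ (u :* b :+ a :* v :+ u :* v :* m) :* m) refl a′ b′ u v m ⟩
            a′ * b′ + (u * b′ + a′ * v + u * v * m) * m  ∎) }
        ; *-assoc = λ a b d → fromEq (*-assoc a b d)
        ; *-identity = (λ a → fromEq (*-identityˡ a)) , (λ a → fromEq (*-identityʳ a))
        ; distrib = (λ a b d → fromEq (distribˡ a b d)) , (λ a b d → fromEq (distribʳ a b d))
        }
      ; *-comm = λ a b → fromEq (*-comm a b)
      }
    }

  difference⇒≈ₘ : ∀ {a b} k → a - b ≈ k * m → a ≈ₘ b
  difference⇒≈ₘ {a} {b} k e = k , (begin
    a              ≈⟨ solve 2 (λ a b → a := b :+ (a :- b)) refl a b ⟩
    b + (a - b)    ≈⟨ +-congˡ e ⟩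
    b + k * m      ∎)

  ≈ₘ⇒difference : ∀ {a b} (e : a ≈ₘ b) → a - b ≈ _≈ₘ_.multiple e * m
  ≈ₘ⇒difference {a} {b} (k , e) = begin
    a - b                ≈⟨ +-congʳ e ⟩
    b + k * m - b        ≈⟨ solve 2 (λ b x → b :+ x :- b := x) refl b (k * m) ⟩
    k * m                ∎

module Units {c ℓ} (R : CommutativeRing c ℓ) where

  open CommutativeRing R hiding (zero)
  open SetoidReasoning setoid
  open SemiringExp semiring using (_^_; ^-homo-*; ^-assocʳ; ^-congˡ)
  open IntegerCoefficients R
  open Summation R
  open QShifted R

  Unit : Carrier → Set (c ⊔ ℓ)
  Unit a = ∃[ u ] u * a ≈ 1#

  unit-1 : Unit 1#
  unit-1 = 1# , *-identityˡ 1#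

  unit-cong : ∀ {a b} → a ≈ b → Unit a → Unit b
  unit-cong a≈b (u , ua≈1) = u , trans (*-congˡ (sym a≈b)) ua≈1

  unit-* : ∀ {a b} → Unit a → Unit b → Unit (a * b)
  unit-* {a} {b} (u , ua≈1) (v , vb≈1) = u * v , (begin
    u * v * (a * b)    ≈⟨ solve 4 (λ u v a b → u :* v :* (a :* b) := (u :* a) :* (v :* b)) refl u v a b ⟩
    (u * a) * (v * b)  ≈⟨ *-cong ua≈1 vb≈1 ⟩
    1# * 1#            ≈⟨ *-identityˡ 1# ⟩
    1#                 ∎)

  unit-factor : ∀ {a b} → Unit (a * b) → Unit b
  unit-factor {a} {b} (u , uab≈1) = u * a , trans (*-assoc u a b) uab≈1

  unit-neg : ∀ {a} → Unit (- a) → Unit a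
  unit-neg {a} (u , e) = - u , trans (solve 2 (λ u a → (:- u) :* a := u :* (:- a)) refl u a) e

  unit-cancel : ∀ {a b} → Unit a → a * b ≈ 0# → b ≈ 0#
  unit-cancel {a} {b} (u , ua≈1) ab≈0 = begin
    b            ≈⟨ *-identityˡ b ⟨
    1# * b       ≈⟨ *-congʳ ua≈1 ⟨
    u * a * b    ≈⟨ *-assoc u a b ⟩
    u * (a * b)  ≈⟨ *-congˡ ab≈0 ⟩
    u * 0#       ≈⟨ zeroʳ u ⟩
    0#           ∎

  geometric : Carrier → ℕ → Carrier
  geometric x n = ∑< n (x ^_)

  geometric-sum : ∀ x n → geometric x n * (1# - x) ≈ 1# - x ^ n
  geometric-sum x zero    = solve 1 (λ x → con 0ℤ :* (con 1ℤ :- x) := con 1ℤ :- con 1ℤ) refl x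
  geometric-sum x (suc n) = begin
    geometric x (suc n) * (1# - x)                ≈⟨ *-congʳ (∑<-last n (x ^_)) ⟩
    (geometric x n + x ^ n) * (1# - x)            ≈⟨ distribʳ _ _ _ ⟩
    geometric x n * (1# - x) + x ^ n * (1# - x)   ≈⟨ +-congʳ (geometric-sum x n) ⟩
    1# - x ^ n + x ^ n * (1# - x)
      ≈⟨ solve 2 (λ y x → con 1ℤ :- y :+ y :* (con 1ℤ :- x) := con 1ℤ :- x :* y) refl (x ^ n) x ⟩
    1# - x ^ suc n                                ∎

  1^n≈1 : ∀ n → 1# ^ n ≈ 1#
  1^n≈1 zero    = refl
  1^n≈1 (suc n) = trans (*-identityˡ _) (1^n≈1 n)

  x^[np]≈1 : ∀ {x} p n → x ^ p ≈ 1# → x ^ (n ℕ.* p) ≈ 1#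
  x^[np]≈1 {x} p n xᵖ≈1 = begin
    x ^ (n ℕ.* p)  ≡⟨ ≡.cong (x ^_) (ℕ.*-comm n p) ⟩
    x ^ (p ℕ.* n)  ≈⟨ ^-assocʳ x p n ⟨
    (x ^ p) ^ n    ≈⟨ ^-congˡ n xᵖ≈1 ⟩
    1# ^ n         ≈⟨ 1^n≈1 n ⟩
    1#             ∎

  -- 1 - x is a multiple of 1 - xⁱ because x or its inverse is a power of xⁱ, by Bézout and xᵖ = 1.
  -- In the second form (xⁱ)ᵇ is the inverse of x, whence the additional factor x and the sign.
  unit-1-xⁱ : ∀ {x} p i → x ^ p ≈ 1# → Bézout.Identity 1 p i → Unit (1# - x) → Unit (1# - x ^ i)
  unit-1-xⁱ {x} p i xᵖ≈1 (Bézout.-+ a b 1+ap≡bi) U = unit-factor (unit-cong (sym (begin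
    geometric (x ^ i) b * (1# - x ^ i)  ≈⟨ geometric-sum (x ^ i) b ⟩
    1# - (x ^ i) ^ b                    ≈⟨ +-congˡ (-‿cong (^-assocʳ x i b)) ⟩
    1# - x ^ (i ℕ.* b)                  ≡⟨ ≡.cong (λ j → 1# - x ^ j)
                                             (≡.trans (ℕ.*-comm i b) (≡.sym 1+ap≡bi)) ⟩
    1# - x * x ^ (a ℕ.* p)              ≈⟨ +-congˡ (-‿cong (*-congˡ (x^[np]≈1 p a xᵖ≈1))) ⟩
    1# - x * 1#                         ≈⟨ +-congˡ (-‿cong (*-identityʳ x)) ⟩
    1# - x                              ∎)) U)
  unit-1-xⁱ {x} p i xᵖ≈1 (Bézout.+- a b 1+bi≡ap) U =
    unit-neg (unit-factor {x * geometric (x ^ i) b} (unit-cong (sym (begin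
    x * geometric (x ^ i) b * - (1# - x ^ i)
      ≈⟨ solve 3 (λ x g f → x :* g :* (:- f) := :- (x :* (g :* f))) refl x _ _ ⟩
    - (x * (geometric (x ^ i) b * (1# - x ^ i)))
      ≈⟨ -‿cong (*-congˡ (geometric-sum (x ^ i) b)) ⟩
    - (x * (1# - (x ^ i) ^ b))
      ≈⟨ solve 2 (λ x y → :- (x :* (con 1ℤ :- y)) := x :* y :- x) refl x _ ⟩
    x * (x ^ i) ^ b - x
      ≈⟨ +-congʳ (*-congˡ (trans (^-assocʳ x i b) (reflexive (≡.cong (x ^_) (ℕ.*-comm i b))))) ⟩
    x ^ suc (b ℕ.* i) - x
      ≡⟨ ≡.cong (λ j → x ^ j - x) 1+bi≡ap ⟩
    x ^ (a ℕ.* p) - x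
      ≈⟨ +-congʳ (x^[np]≈1 p a xᵖ≈1) ⟩
    1# - x ∎)) U))

  -- The sum of 1 - xⁱ over i < p is p, since the powers of x add up to zero. Every summand is a
  -- multiple of 1 - x, so 1 - x divides p.
  unit-1-x : ∀ {x} p → geometric x p ≈ 0# → Unit (∑< p (λ _ → 1#)) → Unit (1# - x)
  unit-1-x {x} p sum≈0 U = unit-factor (unit-cong (sym (begin
    ∑< p (geometric x) * (1# - x)               ≈⟨ ∑<-*ʳ p (1# - x) (geometric x) ⟩
    ∑< p (λ i → geometric x i * (1# - x))
      ≈⟨ ∑<-cong p {λ i → geometric x i * (1# - x)} {λ i → 1# + - 1# * x ^ i} (λ i _ → trans
           (geometric-sum x i) (solve 1 (λ y → con 1ℤ :- y := con 1ℤ :+ (:- con 1ℤ) :* y) refl _)) ⟩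
    ∑< p (λ i → 1# + - 1# * x ^ i)              ≈⟨ ∑<-+ p (λ _ → 1#) (λ i → - 1# * x ^ i) ⟩
    ∑< p (λ _ → 1#) + ∑< p (λ i → - 1# * x ^ i) ≈⟨ +-congˡ (∑<-*ˡ p (- 1#) (x ^_)) ⟨
    ∑< p (λ _ → 1#) + - 1# * geometric x p      ≈⟨ +-congˡ (trans (*-congˡ sum≈0) (zeroʳ _)) ⟩
    ∑< p (λ _ → 1#) + 0#                        ≈⟨ +-identityʳ _ ⟩
    ∑< p (λ _ → 1#)                             ∎)) U)

  geometric≈0⇒x^p≈1 : ∀ {q} p → geometric q p ≈ 0# → q ^ p ≈ 1#
  geometric≈0⇒x^p≈1 {q} p sum≈0 = begin
    q ^ p                             ≈⟨ solve 1 (λ x → x := con 1ℤ :- (con 1ℤ :- x)) refl _ ⟩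
    1# - (1# - q ^ p)                 ≈⟨ +-congˡ (-‿cong (geometric-sum q p)) ⟨
    1# - geometric q p * (1# - q)     ≈⟨ +-congˡ (-‿cong (*-congʳ sum≈0)) ⟩
    1# - 0# * (1# - q)                ≈⟨ solve 1 (λ x → con 1ℤ :- con 0ℤ :* x := con 1ℤ) refl _ ⟩
    1#                                ∎

  unit-^ : ∀ {a} k → Unit a → Unit (a ^ k)
  unit-^ zero    U = unit-1
  unit-^ (suc k) U = unit-* U (unit-^ k U)

  unit-root : ∀ {a} k → a ^ suc k ≈ 1# → Unit a
  unit-root {a} k e = a ^ k , trans (*-comm (a ^ k) a) e

  -- Coprimality with p is used twice: with the exponent 2 to pass from 1 - q to 1 - Q, and with an
  -- exponent j < p to pass from 1 - Q to the factor 1 - Q^j.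
  unit-poch : ∀ {q Q p} → Prime p → 2 < p → Q ≈ q ^ 2 → geometric q p ≈ 0# → Unit (∑< p (λ _ → 1#)) →
                 ∀ k → k < p → Unit (poch Q Q k)
  unit-poch {q} {Q} {p} p-prime 2<p Q≈q² sum≈0 U = go
    where
    qᵖ≈1 : q ^ p ≈ 1#
    qᵖ≈1 = geometric≈0⇒x^p≈1 p sum≈0
    Qᵖ≈1 : Q ^ p ≈ 1#
    Qᵖ≈1 = trans (trans (^-congˡ p Q≈q²) (^-assocʳ q 2 p)) (x^[np]≈1 p 2 qᵖ≈1)
    bézout : ∀ i → suc i < p → Bézout.Identity 1 p (suc i)
    bézout i i<p = coprime-Bézout (prime⇒coprime p-prime i<p)
    unit-1-Q : Unit (1# - Q)
    unit-1-Q = unit-cong (+-congˡ (-‿cong (sym Q≈q²)))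
      (unit-1-xⁱ p 2 qᵖ≈1 (bézout 1 2<p) (unit-1-x p sum≈0 U))
    go : ∀ k → k < p → Unit (poch Q Q k)
    go zero    _   = unit-1
    go (suc k) k<p = unit-* (go k (ℕ.<-trans (ℕ.n<1+n k) k<p))
                            (unit-1-xⁱ p (suc k) Qᵖ≈1 (bézout k k<p) unit-1-Q)

module SquareQuotient {c ℓ} (R : CommutativeRing c ℓ) (w : CommutativeRing.Carrier R) where

  open CommutativeRing R hiding (zero)
  open SemiringExp semiring using (_^_)
  open SetoidReasoning setoid
  open IntegerCoefficients R
  module R/w  = QuotientRing R w
  module R/w² = QuotientRing R (w ^ 2)
  open Units R/w.quotientRing using () renaming (Unit to Unitʷ)
  open Units R/w².quotientRing using () renaming (Unit to Unitʷ²)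

  -- One Newton step: if ua = 1 + kw, then 1 - kw inverts 1 + kw up to a multiple of w².
  unit-lift : ∀ {a} → Unitʷ a → Unitʷ² a
  unit-lift {a} (u , (k R/w., ua≈1+kw)) = u * (1# - k * w) , ((- (k * k)) R/w²., (begin
    u * (1# - k * w) * a              ≈⟨ solve 3 (λ u a z → u :* z :* a := u :* a :* z) refl u a (1# - k * w) ⟩
    u * a * (1# - k * w)              ≈⟨ *-congʳ ua≈1+kw ⟩
    (1# + k * w) * (1# - k * w)       ≈⟨ solve 2 (λ k w → (con 1ℤ :+ k :* w) :* (con 1ℤ :- k :* w) :=
                                           con 1ℤ :+ (:- (k :* k)) :* (w :* (w :* con 1ℤ))) refl k w ⟩
    1# + - (k * k) * w ^ 2            ∎))

-- Signs, values of fractions, transfer to quotients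

module SignedPowers {c ℓ} (R : CommutativeRing c ℓ)
  (q Q : CommutativeRing.Carrier R)
  (Q≈q² : CommutativeRing._≈_ R Q (SemiringExp._^_ (CommutativeRing.semiring R) q 2)) where

  open CommutativeRing R hiding (zero)
  open SetoidReasoning setoid
  open SemiringExp semiring using (_^_; ^-homo-*; ^-assocʳ; ^-congˡ)
  open IntegerCoefficients R
  open QDifferences R Q

  signedPower≈ : ∀ i → signedPower i ≈ (- 1#) ^ i * q ^ (i ℕ.* suc i)
  signedPower≈ zero    = solve 0 (con 1ℤ := con 1ℤ :* con 1ℤ) refl
  signedPower≈ (suc i) = begin
    - (Q ^ suc i * signedPower i)
      ≈⟨ -‿cong (*-cong (trans (^-congˡ (suc i) Q≈q²) (^-assocʳ q 2 (suc i))) (signedPower≈ i)) ⟩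
    - (q ^ (2 ℕ.* suc i) * ((- 1#) ^ i * q ^ (i ℕ.* suc i)))
      ≈⟨ solve 3 (λ a s b → :- (a :* (s :* b)) := :- con 1ℤ :* s :* (a :* b)) refl
           (q ^ (2 ℕ.* suc i)) ((- 1#) ^ i) (q ^ (i ℕ.* suc i)) ⟩
    (- 1#) ^ suc i * (q ^ (2 ℕ.* suc i) * q ^ (i ℕ.* suc i))
      ≈⟨ *-congˡ (^-homo-* q (2 ℕ.* suc i) (i ℕ.* suc i)) ⟨
    (- 1#) ^ suc i * q ^ (2 ℕ.* suc i ℕ.+ i ℕ.* suc i)
      ≡⟨ ≡.cong (λ k → (- 1#) ^ suc i * q ^ k) (index i) ⟩
    (- 1#) ^ suc i * q ^ (suc i ℕ.* suc (suc i)) ∎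
    where
    index : ∀ i → 2 ℕ.* suc i ℕ.+ i ℕ.* suc i ≡ suc i ℕ.* suc (suc i)
    index i = ≡.trans (≡.sym (ℕ.*-distribʳ-+ (suc i) 2 i)) (ℕ.*-comm (suc (suc i)) (suc i))

module Signs {c ℓ} (R : CommutativeRing c ℓ) where

  open CommutativeRing R hiding (zero)
  open SetoidReasoning setoid
  open SemiringExp semiring using (_^_; ^-assocʳ; ^-congˡ)
  open IntegerCoefficients R
  open Units R using (1^n≈1)

  [-1]^even : ∀ m → (- 1#) ^ (2 ℕ.* m) ≈ 1#
  [-1]^even m = begin
    (- 1#) ^ (2 ℕ.* m)   ≈⟨ ^-assocʳ (- 1#) 2 m ⟨
    ((- 1#) ^ 2) ^ m     ≈⟨ ^-congˡ m (solve 0 (:- con 1ℤ :* (:- con 1ℤ :* con 1ℤ) := con 1ℤ) refl) ⟩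
    1# ^ m               ≈⟨ 1^n≈1 m ⟩
    1#                   ∎

  [-1]^odd : ∀ m → (- 1#) ^ suc (2 ℕ.* m) ≈ - 1#
  [-1]^odd m = trans (*-congˡ ([-1]^even m)) (*-identityʳ (- 1#))

  [-1]^² : ∀ i → (- 1#) ^ i * (- 1#) ^ i ≈ 1#
  [-1]^² zero    = *-identityˡ 1#
  [-1]^² (suc i) = trans
    (solve 1 (λ s → :- con 1ℤ :* s :* (:- con 1ℤ :* s) := s :* s) refl ((- 1#) ^ i)) ([-1]^² i)

module FractionValues {c ℓ} (R : CommutativeRing c ℓ) where

  open CommutativeRing R
  open SetoidReasoning setoid
  open IntegerCoefficients R
  private module R = CommutativeRing R

  -- A fraction a/d has value x when a = xd. The left side is the numerator of the unreduced sum
  -- over the denominator de, as in `RF._+_`.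
  value-+ : ∀ {a b x y d e} → a ≈ x * d → b ≈ y * e → a * e + b * d ≈ (x + y) * (d * e)
  value-+ {x = x} {y} {d} {e} a≈ b≈ = trans (+-cong (*-congʳ a≈) (*-congʳ b≈))
    (solve 4 (λ x y d e → x :* d :* e :+ y :* e :* d := (x :+ y) :* (d :* e)) R.refl x y d e)

  value-neg : ∀ {a x d} → a ≈ x * d → - a ≈ - x * d
  value-neg {x = x} {d} a≈ = trans (-‿cong a≈)
    (solve 2 (λ x d → :- (x :* d) := (:- x) :* d) R.refl x d)

module QuotientTransfer {c ℓ} (R : CommutativeRing c ℓ) (m : CommutativeRing.Carrier R) where

  private
    R/m = QuotientRing.quotientRing R m
    module R = CommutativeRing R
    module R/m = CommutativeRing R/m
  open R using (Carrier; _+_; _*_; -_; 1#)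
  open SemiringExp R.semiring using (_^_)
  open SemiringExp R/m.semiring using () renaming (_^_ to _^ₘ_)
  open QShifted R using (poch)
  open QShifted R/m using () renaming (poch to pochₘ)
  open SemiringSum R.semiring using (sum)
  open SemiringSum R/m.semiring using () renaming (sum to sumₘ)

  -- The two bundles share their operations but not their equality, so functions defined by
  -- recursion over them agree only by induction.
  ^-≡ : ∀ x n → x ^ₘ n ≡ x ^ n
  ^-≡ x zero    = ≡.refl
  ^-≡ x (suc n) = ≡.cong (x *_) (^-≡ x n)

  poch-≡ : ∀ a b n → pochₘ a b n ≡ poch a b n
  poch-≡ a b zero    = ≡.refl
  poch-≡ a b (suc n) = ≡.cong₂ _*_ (poch-≡ a b n) (≡.cong (λ x → 1# + - (a * x)) (^-≡ b n))

  sum-≡ : ∀ {n} {f g : Fin n → Carrier} → (∀ i → f i ≡ g i) → sumₘ f ≡ sum g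
  sum-≡ {zero}  f≡g = ≡.refl
  sum-≡ {suc n} f≡g = ≡.cong₂ _+_ (f≡g zero) (sum-≡ {n} (f≡g ∘ suc))

module RingFacts {c ℓ} (R : CommutativeRing c ℓ) where

  open CommutativeRing R hiding (zero)
  open SetoidReasoning setoid
  open IntegerCoefficients R
  open Units R

  -- The right side is spelled as zero plus a multiple of g ^ 2 in unfolded form, the shape of an
  -- equality in the quotient by g ^ 2.
  square-≈ : ∀ {e g d} → g * d ≈ e → e * e ≈ 0# + d * d * (g * (g * 1#))
  square-≈ {e} {g} {d} gd≈e = trans (sym (*-cong gd≈e gd≈e))
    (solve 2 (λ g d → g :* d :* (g :* d) := con 0ℤ :+ d :* d :* (g :* (g :* con 1ℤ))) refl g d)

  quotient-value : ∀ a {d e u v} → u * d ≈ 1# → v * e ≈ 1# → a ≈ a * (u * v) * (d * e)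
  quotient-value a {d} {e} {u} {v} ud≈1 ve≈1 = sym (begin
    a * (u * v) * (d * e)    ≈⟨ solve 5 (λ a u v d e → a :* (u :* v) :* (d :* e) :=
                                  a :* ((u :* d) :* (v :* e))) refl a u v d e ⟩
    a * (u * d * (v * e))    ≈⟨ *-congˡ (*-cong ud≈1 ve≈1) ⟩
    a * (1# * 1#)            ≈⟨ solve 1 (λ a → a :* (con 1ℤ :* con 1ℤ) := a) refl a ⟩
    a                        ∎)

  halve : ∀ {x} → Unit (1# + 1#) → x + x ≈ 1# + 1# → x ≈ 1#
  halve {x} U e = begin
    x              ≈⟨ solve 1 (λ x → x := x :- con 1ℤ :+ con 1ℤ) refl x ⟩
    x - 1# + 1#    ≈⟨ +-congʳ (unit-cancel U (begin
      (1# + 1#) * (x - 1#)   ≈⟨ solve 1 (λ x → (con 1ℤ :+ con 1ℤ) :* (x :- con 1ℤ) :=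
                                               x :+ x :- (con 1ℤ :+ con 1ℤ)) refl x ⟩
      x + x - (1# + 1#)      ≈⟨ +-congʳ e ⟩
      1# + 1# - (1# + 1#)    ≈⟨ -‿inverseʳ _ ⟩
      0#                     ∎)) ⟩
    0# + 1#        ≈⟨ +-identityˡ 1# ⟩
    1#             ∎

  -- In the application x is the sum, s the sign and t a power of q. The factors `1#` are those in
  -- the numerator and denominator of the unsimplified product of s with 1/t.
  sign-value : ∀ {x s t} → x * (s * t) ≈ 1# → s * s ≈ 1# → s * 1# ≈ x * (1# * t)
  sign-value {x} {s} {t} xst≈1 s²≈1 = begin
    s * 1#                ≈⟨ *-congˡ xst≈1 ⟨
    s * (x * (s * t))     ≈⟨ solve 3 (λ s x t → s :* (x :* (s :* t)) := s :* s :* (x :* t)) refl s x t ⟩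
    s * s * (x * t)       ≈⟨ *-congʳ s²≈1 ⟩
    1# * (x * t)          ≈⟨ solve 2 (λ x t → con 1ℤ :* (x :* t) := x :* (con 1ℤ :* t)) refl x t ⟩
    x * (1# * t)          ∎

-- The sum modulo w², where w stands for [p]

module SumModuloSquare {c ℓ} (R : CommutativeRing c ℓ)
  (q Q w : CommutativeRing.Carrier R)
  (Q≈q² : CommutativeRing._≈_ R Q (SemiringExp._^_ (CommutativeRing.semiring R) q 2))
  (N p : ℕ) (p≡ : p ≡ suc (2 ℕ.* N)) (2<p : 2 < p) (p-prime : Prime p)
  (geometric≈w : CommutativeRing._≈_ R (Units.geometric R q p) w)
  (2-unit : Units.Unit R (CommutativeRing._+_ R (CommutativeRing.1# R) (CommutativeRing.1# R)))
  (p-unit : Units.Unit R (Summation.∑< R p (λ _ → CommutativeRing.1# R)))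
  where

  open CommutativeRing R hiding (zero)
  open SemiringExp semiring using (_^_)
  open Summation R
  open QShifted R
  open SquareQuotient R w
  private
    module M = CommutativeRing R/w.quotientRing
    module S = CommutativeRing R/w².quotientRing
    module Mᵤ = Units R/w.quotientRing
    module Sᵤ = Units R/w².quotientRing
    module Mₜ = QuotientTransfer R w
    module Sₜ = QuotientTransfer R (w ^ 2)

  private
    geometric≈0 : Mᵤ.geometric q p M.≈ 0#
    geometric≈0 = M.trans (M.reflexive (Mₜ.sum-≡ {p} (λ i → Mₜ.^-≡ q (toℕ i))))
      (1# R/w., trans geometric≈w (sym (trans (+-identityˡ (1# * w)) (*-identityˡ w))))

    p-unitʷ : Mᵤ.Unit (Summation.∑< R/w.quotientRing p (λ _ → 1#))
    p-unitʷ = ≡.subst Mᵤ.Unit (≡.sym (Mₜ.sum-≡ {p} (λ _ → ≡.refl)))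
      (proj₁ p-unit , R/w.fromEq (proj₂ p-unit))

    ≤2N⇒<p : ∀ {k} → k ≤ 2 ℕ.* N → k < p
    ≤2N⇒<p {k} k≤2N = ≡.subst (k <_) (≡.sym p≡) (s≤s k≤2N)

  poch-unit : ∀ k → k ≤ 2 ℕ.* N → Mᵤ.Unit (poch Q Q k)
  poch-unit k k≤2N = ≡.subst Mᵤ.Unit (Mₜ.poch-≡ Q Q k)
    (Mᵤ.unit-poch p-prime 2<p (R/w.fromEq Q≈q²) geometric≈0 p-unitʷ k (≤2N⇒<p k≤2N))

  q^-unit : ∀ k → Mᵤ.Unit (q ^ k)
  q^-unit k = ≡.subst Mᵤ.Unit (Mₜ.^-≡ q k) (Mᵤ.unit-^ k (Mᵤ.unit-root {q} (2 ℕ.* N)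
    (≡.subst (λ j → q M^.^ j M.≈ 1#) p≡ (Mᵤ.geometric≈0⇒x^p≈1 {q} p geometric≈0))))
    where module M^ = SemiringExp M.semiring

  private
    Q≈q²ʷ² : Q S.≈ q * (q * 1#)
    Q≈q²ʷ² = R/w².fromEq Q≈q²

    module T = TerminatingSum R/w².quotientRing q Q Q≈q²ʷ² N
    module 𝔻 = QDifferences R/w².quotientRing Q

    -- By the geometric sum ε is w(1 - q).
    ε²≈0 : T.ε * T.ε S.≈ 0#
    ε²≈0 = (d * d) R/w²., RingFacts.square-≈ R {T.ε} {w} {d} wd≈ε
      where
      d : Carrier
      d = 1# - q
      wd≈ε : w * d ≈ T.ε
      wd≈ε = trans (trans (*-congʳ (sym geometric≈w)) (Units.geometric-sum R q p))
        (reflexive (≡.cong (λ x → 1# - x)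
          (≡.trans (≡.cong (q ^_) p≡) (≡.sym (Sₜ.^-≡ q (suc (2 ℕ.* N)))))))

    poch-inverse : ∀ k → k ≤ 2 ℕ.* N → Sᵤ.Unit (poch Q Q k)
    poch-inverse k k≤2N = unit-lift (poch-unit k k≤2N)

    inverse : ∀ k → ∃[ u ] (k ≤ 2 ℕ.* N → u * poch Q Q k S.≈ 1#)
    inverse k with k ℕ.≤? 2 ℕ.* N
    ... | yes k≤2N = proj₁ (poch-inverse k k≤2N) , λ _ → proj₂ (poch-inverse k k≤2N)
    -- A default that makes the inverse a function on all of ℕ; beyond 2N nothing is claimed about
    -- it.
    ... | no  k≰2N = 0# , λ k≤2N → contradiction k≤2N k≰2N

  k+s≤2N : ∀ {k s} → k ≤ N → s ≤ N → k ℕ.+ s ≤ 2 ℕ.* N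
  k+s≤2N {k} {s} k≤N s≤N = ≡.subst (k ℕ.+ s ≤_) (≡.cong (N ℕ.+_) (≡.sym (ℕ.+-identityʳ N)))
                             (ℕ.+-mono-≤ k≤N s≤N)

  k≤2N : ∀ {k} → k ≤ N → k ≤ 2 ℕ.* N
  k≤2N k≤N = ℕ.≤-trans k≤N (ℕ.m≤m+n N _)

  module _ (s : ℕ) (s≤N : s ≤ N) where

    IsTermValue : (ℕ → Carrier) → Set (c ⊔ ℓ)
    IsTermValue v = ∀ k → k ≤ N →
      poch q Q k * poch q Q (k ℕ.+ s) S.≈ v k * (poch Q Q k * poch Q Q (k ℕ.+ s))

    termValues : ∃[ v ] IsTermValue v
    termValues = (λ k → poch q Q k * poch q Q (k ℕ.+ s) * (proj₁ (inverse k) * proj₁ (inverse (k ℕ.+ s))))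
      , λ k k≤N → RingFacts.quotient-value R/w².quotientRing (poch q Q k * poch q Q (k ℕ.+ s))
          {poch Q Q k} {poch Q Q (k ℕ.+ s)} {proj₁ (inverse k)} {proj₁ (inverse (k ℕ.+ s))}
          (proj₂ (inverse k) (k≤2N k≤N)) (proj₂ (inverse (k ℕ.+ s)) (k+s≤2N k≤N s≤N))

    module _ (v : ℕ → Carrier) (v-value : IsTermValue v) where

      private
        pochₛ : Carrier → Carrier → ℕ → Carrier
        pochₛ = QShifted.poch R/w².quotientRing

        ∑<ₛ : ℕ → (ℕ → Carrier) → Carrier
        ∑<ₛ = Summation.∑< R/w².quotientRing

        v-equation : ∀ k → k ≤ N →
          v k * (pochₛ Q Q k * pochₛ Q Q (k ℕ.+ s)) S.≈ pochₛ q Q k * pochₛ q Q (k ℕ.+ s)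
        v-equation k k≤N = S.trans
          (S.reflexive (≡.cong₂ (λ a b → v k * (a * b)) (Sₜ.poch-≡ Q Q k) (Sₜ.poch-≡ Q Q (k ℕ.+ s))))
          (S.trans (S.sym (v-value k k≤N))
            (S.reflexive (≡.sym (≡.cong₂ _*_ (Sₜ.poch-≡ q Q k) (Sₜ.poch-≡ q Q (k ℕ.+ s))))))

        pochₛ-inverse : ∀ k → k ≤ 2 ℕ.* N → ∃[ u ] u * pochₛ Q Q k S.≈ 1#
        pochₛ-inverse k k≤2N = ≡.subst Sᵤ.Unit (≡.sym (Sₜ.poch-≡ Q Q k)) (poch-inverse k k≤2N)

        2-unitʷ² : Sᵤ.Unit (1# + 1#)
        2-unitʷ² = proj₁ 2-unit , R/w².fromEq (proj₂ 2-unit)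

        sum*signedPower≈1 : ∑<ₛ (suc N) v * 𝔻.signedPower N S.≈ 1#
        sum*signedPower≈1 = RingFacts.halve R/w².quotientRing 2-unitʷ²
          (T.doubled-sum ε²≈0 pochₛ-inverse s s≤N v v-equation)

        signedPower≈ : 𝔻.signedPower N S.≈ (- 1#) ^ N * q ^ (N ℕ.* suc N)
        signedPower≈ = S.trans (SignedPowers.signedPower≈ R/w².quotientRing q Q Q≈q²ʷ² N)
          (S.reflexive (≡.cong₂ _*_ (Sₜ.^-≡ (- 1#) N) (Sₜ.^-≡ q (N ℕ.* suc N))))

      -- For `a` the Legendre symbol as a constant, this says that the right side of the theorem has
      -- the sum as its value: numerator = value times denominator.
      sum-value : ∀ {a} → a ≈ (- 1#) ^ N → a * 1# S.≈ ∑< (suc N) v * (1# * q ^ (N ℕ.* suc N))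
      sum-value a≈sign = S.trans (R/w².fromEq (*-congʳ a≈sign))
        (RingFacts.sign-value R/w².quotientRing {∑< (suc N) v} {(- 1#) ^ N} {q ^ (N ℕ.* suc N)}
          (S.trans (S.*-congˡ (S.sym signedPower≈))
            (≡.subst (λ t → t * 𝔻.signedPower N S.≈ 1#) (Sₜ.sum-≡ {suc N} {v ∘ toℕ} {v ∘ toℕ} (λ _ → ≡.refl)) sum*signedPower≈1))
          (R/w².fromEq (Signs.[-1]^² R N)))

-- Pairs with their common factor removed

module Reductions {c ℓ} (R : CommutativeRing c ℓ) where

  open CommutativeRing R hiding (zero)
  open SetoidReasoning setoid
  open IntegerCoefficients R

  -- Coprimality of the cofactors is kept as a Bézout identity, which every step of Euclid's
  -- algorithm can transform explicitly.
  record Reduction (a b : Carrier) : Set (c ⊔ ℓ) where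
    field
      common a′ b′ u v : Carrier
      a≈     : a ≈ common * a′
      b≈     : b ≈ common * b′
      bézout : u * a′ + v * b′ ≈ 1#

  open Reduction

  reduction-cong : ∀ {a a₁ b b₁} → a ≈ a₁ → b ≈ b₁ → Reduction a b → Reduction a₁ b₁
  reduction-cong a≈a₁ b≈b₁ r = record
    { a≈ = trans (sym a≈a₁) (a≈ r) ; b≈ = trans (sym b≈b₁) (b≈ r) ; bézout = bézout r }

  reduction-sym : ∀ {a b} → Reduction a b → Reduction b a
  reduction-sym r = record
    { a≈ = b≈ r ; b≈ = a≈ r ; bézout = trans (+-comm _ _) (bézout r) }

  reduction-0 : ∀ a → Reduction 0# a
  reduction-0 a = record
    { common = a ; a′ = 0# ; b′ = 1# ; u = 0# ; v = 1#
    ; a≈ = sym (zeroʳ a) ; b≈ = sym (*-identityʳ a)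
    ; bézout = solve 0 (con 0ℤ :* con 0ℤ :+ con 1ℤ :* con 1ℤ := con 1ℤ) refl }

  reduction-scale : ∀ {a b} x → Reduction a b → Reduction (x * a) (x * b)
  reduction-scale x r = record
    { a≈ = trans (*-congˡ (a≈ r)) (sym (*-assoc x _ _))
    ; b≈ = trans (*-congˡ (b≈ r)) (sym (*-assoc x _ _))
    ; bézout = bézout r }

  reduction-addMultiple : ∀ {a b} x → Reduction a b → Reduction (a + x * b) b
  reduction-addMultiple {a} {b} x r = record
    { common = common r ; a′ = a′ r + x * b′ r ; b′ = b′ r ; u = u r ; v = v r - u r * x
    ; a≈ = trans (+-cong (a≈ r) (*-congˡ (b≈ r)))
        (solve 4 (λ g a x b → g :* a :+ x :* (g :* b) := g :* (a :+ x :* b)) refl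
          (common r) (a′ r) x (b′ r))
    ; b≈ = b≈ r
    ; bézout = trans
        (solve 5 (λ u v x a b → u :* (a :+ x :* b) :+ (v :- u :* x) :* b := u :* a :+ v :* b) refl
          (u r) (v r) x (a′ r) (b′ r))
        (bézout r) }

  -- A factor coprime to the cofactor of b creates no new common factor; the two Bézout identities
  -- are combined.
  reduction-coprimeFactor : ∀ {a b} x (r : Reduction a b) →
    (∃[ s ] ∃[ t ] s * x + t * b′ r ≈ 1#) → Reduction (x * a) b
  reduction-coprimeFactor {a} {b} x r (s , t , sx+tb′≈1) = record
    { common = common r ; a′ = x * a′ r ; b′ = b′ r ; u = u r * s ; v = u r * a′ r * t + v r
    ; a≈ = trans (*-congˡ (a≈ r))
        (solve 3 (λ x g a → x :* (g :* a) := g :* (x :* a)) refl x (common r) (a′ r))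
    ; b≈ = b≈ r
    ; bézout = begin
        u r * s * (x * a′ r) + (u r * a′ r * t + v r) * b′ r
          ≈⟨ solve 7 (λ u s x a t v b → u :* s :* (x :* a) :+ (u :* a :* t :+ v) :* b :=
               u :* a :* (s :* x :+ t :* b) :+ v :* b) refl (u r) s x (a′ r) t (v r) (b′ r) ⟩
        u r * a′ r * (s * x + t * b′ r) + v r * b′ r   ≈⟨ +-congʳ (*-congˡ sx+tb′≈1) ⟩
        u r * a′ r * 1# + v r * b′ r                   ≈⟨ +-congʳ (*-identityʳ _) ⟩
        u r * a′ r + v r * b′ r                        ≈⟨ bézout r ⟩
        1#                                             ∎ }

-- The polynomial ring over ℚ

module PolynomialRing where

  open Convolution ℚ.+-*-commutativeRing

  coeff-+ : ∀ P Q n → coeff (P Poly.+ Q) n ≡ coeff P n ℚ.+ coeff Q n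
  coeff-+ []      Q       n       = ≡.sym (ℚ.+-identityˡ _)
  coeff-+ (a ∷ P) []      n       = ≡.sym (ℚ.+-identityʳ _)
  coeff-+ (a ∷ P) (b ∷ Q) zero    = ≡.refl
  coeff-+ (a ∷ P) (b ∷ Q) (suc n) = coeff-+ P Q n

  coeff-scale : ∀ c P n → coeff (Poly.scale c P) n ≡ c ℚ.* coeff P n
  coeff-scale c []      n       = ≡.sym (ℚ.*-zeroʳ c)
  coeff-scale c (a ∷ P) zero    = ≡.refl
  coeff-scale c (a ∷ P) (suc n) = coeff-scale c P n

  coeff-neg : ∀ P n → coeff (Poly.- P) n ≡ ℚ.- coeff P n
  coeff-neg []      n       = ≡.refl
  coeff-neg (a ∷ P) zero    = ≡.refl
  coeff-neg (a ∷ P) (suc n) = coeff-neg P n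

  coeff-* : ∀ P Q n → coeff (P Poly.* Q) n ≡ conv (coeff P) (coeff Q) n
  coeff-* []      Q n       = ≡.sym (conv-zeroˡ (coeff Q) n)
  coeff-* (a ∷ P) Q zero    = ≡.trans (coeff-+ (Poly.scale a Q) _ 0)
    (≡.trans (ℚ.+-identityʳ _) (coeff-scale a Q 0))
  coeff-* (a ∷ P) Q (suc n) = ≡.trans (coeff-+ (Poly.scale a Q) _ (suc n))
    (≡.cong₂ ℚ._+_ (coeff-scale a Q (suc n)) (coeff-* P Q n))

  open Poly using (_≈_; coeffs-≡; coeff-≡)

  ≈-isEquivalence : IsEquivalence _≈_
  ≈-isEquivalence = record
    { refl  = coeffs-≡ λ n → ≡.refl
    ; sym   = λ e → coeffs-≡ λ n → ≡.sym (coeff-≡ e n)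
    ; trans = λ e e′ → coeffs-≡ λ n → ≡.trans (coeff-≡ e n) (coeff-≡ e′ n)
    }

  +-via : ∀ P Q {f : ℕ → ℚ} → (∀ n → coeff P n ℚ.+ coeff Q n ≡ f n) → ∀ n → coeff (P Poly.+ Q) n ≡ f n
  +-via P Q eq n = ≡.trans (coeff-+ P Q n) (eq n)

  1*-conv : ∀ g n → conv (coeff Poly.1#) g n ≡ g n
  1*-conv g zero    = ℚ.*-identityˡ _
  1*-conv g (suc n) = ≡.trans (≡.cong₂ ℚ._+_ (ℚ.*-identityˡ (g (suc n))) (conv-zeroˡ g n)) (ℚ.+-identityʳ _)

  *-comm′ : ∀ P Q → P Poly.* Q ≈ Q Poly.* P
  *-comm′ P Q = coeffs-≡ λ n → ≡.trans (coeff-* P Q n)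
    (≡.trans (conv-comm (coeff P) (coeff Q) n) (≡.sym (coeff-* Q P n)))

  *-identityˡ′ : ∀ P → Poly.1# Poly.* P ≈ P
  *-identityˡ′ P = coeffs-≡ λ n → ≡.trans (coeff-* Poly.1# P n) (1*-conv (coeff P) n)

  *-distribʳ′ : ∀ P Q S → (Q Poly.+ S) Poly.* P ≈ Q Poly.* P Poly.+ S Poly.* P
  *-distribʳ′ P Q S = coeffs-≡ λ n → begin
    coeff ((Q Poly.+ S) Poly.* P) n                 ≡⟨ coeff-* (Q Poly.+ S) P n ⟩
    conv (coeff (Q Poly.+ S)) (coeff P) n           ≡⟨ conv-cong (coeff-+ Q S) (λ _ → ≡.refl) n ⟩
    conv (λ i → coeff Q i ℚ.+ coeff S i) (coeff P) n
      ≡⟨ conv-distribʳ (coeff P) (coeff Q) (coeff S) n ⟩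
    conv (coeff Q) (coeff P) n ℚ.+ conv (coeff S) (coeff P) n
      ≡⟨ ≡.cong₂ ℚ._+_ (coeff-* Q P n) (coeff-* S P n) ⟨
    coeff (Q Poly.* P) n ℚ.+ coeff (S Poly.* P) n   ≡⟨ coeff-+ (Q Poly.* P) (S Poly.* P) n ⟨
    coeff (Q Poly.* P Poly.+ S Poly.* P) n          ∎
    where open ≡.≡-Reasoning

  polyRing : CommutativeRing 0ℓ 0ℓ
  polyRing = record
    { Carrier = Poly ; _≈_ = _≈_ ; _+_ = Poly._+_ ; _*_ = Poly._*_ ; -_ = Poly.-_
    ; 0# = Poly.0# ; 1# = Poly.1#
    ; isCommutativeRing = record
      { isRing = record
        { +-isAbelianGroup = record
          { isGroup = record
            { isMonoid = record
              { isSemigroup = record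
                { isMagma = record
                  { isEquivalence = ≈-isEquivalence
                  ; ∙-cong = λ {P} {P′} {Q} {Q′} e e′ → coeffs-≡ (+-via P Q λ n →
                      ≡.trans (≡.cong₂ ℚ._+_ (coeff-≡ e n) (coeff-≡ e′ n)) (≡.sym (coeff-+ P′ Q′ n)))
                  }
                ; assoc = λ P Q S → coeffs-≡ (+-via (P Poly.+ Q) S λ n →
                    ≡.trans (≡.cong (ℚ._+ coeff S n) (coeff-+ P Q n))
                    (≡.trans (ℚ.+-assoc (coeff P n) (coeff Q n) (coeff S n))
                    (≡.trans (≡.cong (coeff P n ℚ.+_) (≡.sym (coeff-+ Q S n)))
                             (≡.sym (coeff-+ P (Q Poly.+ S) n)))))
                }
              ; identity = (λ P → coeffs-≡ λ n → ≡.refl)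
                         , (λ P → coeffs-≡ (+-via P [] λ n → ℚ.+-identityʳ (coeff P n)))
              }
            ; inverse = (λ P → coeffs-≡ (+-via (Poly.- P) P λ n →
                           ≡.trans (≡.cong (ℚ._+ coeff P n) (coeff-neg P n)) (ℚ.+-inverseˡ (coeff P n))))
                      , (λ P → coeffs-≡ (+-via P (Poly.- P) λ n →
                           ≡.trans (≡.cong (coeff P n ℚ.+_) (coeff-neg P n)) (ℚ.+-inverseʳ (coeff P n))))
            ; ⁻¹-cong = λ {P} {Q} e → coeffs-≡ λ n → ≡.trans (coeff-neg P n)
                (≡.trans (≡.cong ℚ.-_ (coeff-≡ e n)) (≡.sym (coeff-neg Q n)))
            }
          ; comm = λ P Q → coeffs-≡ (+-via P Q λ n →
              ≡.trans (ℚ.+-comm (coeff P n) (coeff Q n)) (≡.sym (coeff-+ Q P n)))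
          }
        ; *-cong = λ {P} {P′} {Q} {Q′} e e′ → coeffs-≡ λ n → ≡.trans (coeff-* P Q n)
            (≡.trans (conv-cong (coeff-≡ e) (coeff-≡ e′) n) (≡.sym (coeff-* P′ Q′ n)))
        ; *-assoc = λ P Q S → coeffs-≡ λ n → ≡.trans (coeff-* (P Poly.* Q) S n)
            (≡.trans (conv-cong (coeff-* P Q) (λ _ → ≡.refl) n)
            (≡.trans (conv-assoc (coeff P) (coeff Q) (coeff S) n)
            (≡.trans (conv-cong {coeff P} (λ _ → ≡.refl) (λ i → ≡.sym (coeff-* Q S i)) n)
                     (≡.sym (coeff-* P (Q Poly.* S) n)))))
        ; *-identity = *-identityˡ′
                     , (λ P → IsEquivalence.trans ≈-isEquivalence (*-comm′ P Poly.1#) (*-identityˡ′ P))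
        ; distrib = (λ P Q S → coeffs-≡ λ n → ≡.trans (coeff-≡ (*-comm′ P (Q Poly.+ S)) n)
                       (≡.trans (coeff-≡ (*-distribʳ′ P Q S) n)
                       (≡.trans (coeff-+ (Q Poly.* P) (S Poly.* P) n)
                       (≡.trans (≡.cong₂ ℚ._+_ (coeff-≡ (*-comm′ Q P) n) (coeff-≡ (*-comm′ S P) n))
                                (≡.sym (coeff-+ (P Poly.* Q) (P Poly.* S) n))))))
                  , *-distribʳ′
        }
      ; *-comm = *-comm′
      }
    }

open PolynomialRing using (polyRing; coeff-+; coeff-scale; coeff-*)

-- Euclid's algorithm and lowest terms

module LowestTerms where

  open import Algebra.Definitions.RawMagma using (_,_)
  open Reductions polyRing
  open Poly using (_≈_; coeffs-≡; coeff-≡; q)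
  open CommutativeRing polyRing using (refl; sym; trans; +-congʳ; +-congˡ; *-congˡ; +-cong)

  coeff₀-* : ∀ P Q → coeff (P Poly.* Q) 0 ≡ coeff P 0 ℚ.* coeff Q 0
  coeff₀-* P Q = coeff-* P Q 0

  ∷-cong : ∀ {a b P Q} → a ≡ b → P ≈ Q → a ∷ P ≈ b ∷ Q
  ∷-cong a≡b P≈Q = coeffs-≡ λ where
    zero    → a≡b
    (suc n) → coeff-≡ P≈Q n

  scale≈const* : ∀ c P → Poly.scale c P ≈ Poly.const c Poly.* P
  scale≈const* c P = coeffs-≡ λ n → ≡.sym (≡.trans (coeff-+ (Poly.scale c P) (0ℚ ∷ []) n)
    (≡.trans (≡.cong (coeff (Poly.scale c P) n ℚ.+_) (coeff-0∷[] n)) (ℚ.+-identityʳ _)))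
    where
    coeff-0∷[] : ∀ n → coeff (0ℚ ∷ []) n ≡ 0ℚ
    coeff-0∷[] zero    = ≡.refl
    coeff-0∷[] (suc n) = ≡.refl

  q*≈0∷ : ∀ P → q Poly.* P ≈ 0ℚ ∷ P
  q*≈0∷ P = coeffs-≡ λ where
      zero    → ≡.trans (coeff₀-* q P) (ℚ.*-zeroˡ (coeff P 0))
      (suc n) → ≡.trans (coeff-+ (Poly.scale 0ℚ P) _ (suc n))
        (≡.trans (≡.cong₂ ℚ._+_ (≡.trans (coeff-scale 0ℚ P (suc n)) (ℚ.*-zeroˡ (coeff P (suc n))))
                                (coeff-≡ (1*≈ P) n))
        (ℚ.+-identityˡ _))
    where
    1*≈ : ∀ P → Poly.1# Poly.* P ≈ P
    1*≈ = CommutativeRing.*-identityˡ polyRing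

  a∷P≈a+qP : ∀ a P → a ∷ P ≈ Poly.const a Poly.+ q Poly.* P
  a∷P≈a+qP a P = trans (∷-head a P) (+-congˡ {Poly.const a} (sym (q*≈0∷ P)))
    where
    ∷-head : ∀ a P → a ∷ P ≈ (a ∷ []) Poly.+ (0ℚ ∷ P)
    ∷-head a P = ∷-cong (≡.sym (ℚ.+-identityʳ a)) refl

  constants-multiply : ∀ {c d} → c ℚ.* d ≡ 1ℚ → Poly.const c Poly.* Poly.const d ≈ Poly.1#
  constants-multiply {c} {d} cd≡1 = trans (sym (scale≈const* c (Poly.const d))) (∷-cong cd≡1 refl)

  -- Modulo q a polynomial is its constant term, here an invertible rational.
  q-coprime : ∀ P → coeff P 0 ≢ 0ℚ → ∃[ s ] ∃[ t ] s Poly.* q Poly.+ t Poly.* P ≈ Poly.1#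
  q-coprime []      c≢0 = contradiction ≡.refl c≢0
  q-coprime (a ∷ P) a≢0 = Poly.- (i Poly.* P) , i , (begin
    Poly.- (i Poly.* P) Poly.* q Poly.+ i Poly.* (a ∷ P)
      ≈⟨ +-congˡ {Poly.- (i Poly.* P) Poly.* q} (*-congˡ {i} (a∷P≈a+qP a P)) ⟩
    Poly.- (i Poly.* P) Poly.* q Poly.+ i Poly.* (Poly.const a Poly.+ q Poly.* P)
      ≈⟨ solve 4 (λ i P q a → (:- (i :* P)) :* q :+ i :* (a :+ q :* P) := i :* a) refl i P q (Poly.const a) ⟩
    i Poly.* Poly.const a   ≈⟨ constants-multiply {ℚ.1/ a} {a} (ℚ.*-inverseˡ a) ⟩
    Poly.1#                 ∎)
    where
    open SetoidReasoning (CommutativeRing.setoid polyRing)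
    open IntegerCoefficients polyRing
    instance _ = ℚ.≢-nonZero a≢0
    i = Poly.const (ℚ.1/ a)

  reduction-q : ∀ {P Q} → coeff Q 0 ≢ 0ℚ → Reduction P Q → Reduction (q Poly.* P) Q
  reduction-q {P} {Q} Q₀≢0 r = reduction-coprimeFactor q r (q-coprime (Reduction.b′ r) λ b′₀≡0 →
    Q₀≢0 (≡.trans (coeff-≡ (Reduction.b≈ r) 0)
         (≡.trans (coeff₀-* (Reduction.common r) (Reduction.b′ r))
         (≡.trans (≡.cong (coeff (Reduction.common r) 0 ℚ.*_) b′₀≡0) (ℚ.*-zeroʳ (coeff (Reduction.common r) 0))))))

  length-+ : ∀ P Q → length (P Poly.+ Q) ≡ length P ℕ.⊔ length Q
  length-+ []      Q       = ≡.refl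
  length-+ (a ∷ P) []      = ≡.refl
  length-+ (a ∷ P) (b ∷ Q) = ≡.cong suc (length-+ P Q)

  -- Subtracting a/b times `b ∷ Q` from `a ∷ P` removes the constant term. What is left is q times
  -- the first polynomial of the premise, and q is coprime to `b ∷ Q`.
  cancel-constants : ∀ a P b Q .{{_ : ℚ.NonZero b}} → b ≢ 0ℚ →
    Reduction (P Poly.+ Poly.scale (ℚ.- (a ℚ.* ℚ.1/ b)) Q) (b ∷ Q) → Reduction (a ∷ P) (b ∷ Q)
  cancel-constants a P b Q b≢0 r =
    reduction-cong (sym a∷P≈) refl (reduction-addMultiple (Poly.const c) (reduction-q b≢0 r))
    where
    open SetoidReasoning (CommutativeRing.setoid polyRing)
    open IntegerCoefficients polyRing
    c : ℚ
    c = a ℚ.* ℚ.1/ b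
    cb≡a : c ℚ.* b ≡ a
    cb≡a = ≡.trans (ℚ.*-assoc a (ℚ.1/ b) b)
             (≡.trans (≡.cong (a ℚ.*_) (ℚ.*-inverseˡ b)) (ℚ.*-identityʳ a))
    a∷P≈ : a ∷ P ≈ q Poly.* (P Poly.+ Poly.scale (ℚ.- c) Q) Poly.+ Poly.const c Poly.* (b ∷ Q)
    a∷P≈ = begin
      a ∷ P
        ≈⟨ a∷P≈a+qP a P ⟩
      Poly.const a Poly.+ q Poly.* P
        ≈⟨ +-congʳ {q Poly.* P} (∷-cong (≡.sym cb≡a) refl) ⟩
      Poly.scale c (Poly.const b) Poly.+ q Poly.* P
        ≈⟨ +-congʳ {q Poly.* P} (scale≈const* c (Poly.const b)) ⟩
      Poly.const c Poly.* Poly.const b Poly.+ q Poly.* P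
        ≈⟨ solve 5 (λ c b q P Q → c :* b :+ q :* P :=
             q :* (P :+ (:- c) :* Q) :+ c :* (b :+ q :* Q)) refl
             (Poly.const c) (Poly.const b) q P Q ⟩
      q Poly.* (P Poly.+ Poly.const (ℚ.- c) Poly.* Q) Poly.+ Poly.const c Poly.* (Poly.const b Poly.+ q Poly.* Q)
        ≈⟨ +-cong (*-congˡ {q} (+-congˡ {P} (scale≈const* (ℚ.- c) Q))) (*-congˡ {Poly.const c} (a∷P≈a+qP b Q)) ⟨
      q Poly.* (P Poly.+ Poly.scale (ℚ.- c) Q) Poly.+ Poly.const c Poly.* (b ∷ Q) ∎

  -- A multiple of the shorter list is added to the longer one, which does not grow. Division by q
  -- has removed an entry, so the total length drops and the fuel suffices.
  length-+-scale : ∀ P c Q → length Q ≤ length P → length (P Poly.+ Poly.scale c Q) ≡ length P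
  length-+-scale P c Q Q≤P = ≡.trans (length-+ P (Poly.scale c Q))
    (≡.trans (≡.cong (length P ℕ.⊔_) (List.length-map (c ℚ.*_) Q)) (ℕ.m≥n⇒m⊔n≡m Q≤P))

  -- Euclid's algorithm from the bottom: cancel constant terms and divide by q.
  reduce : ∀ fuel P Q → length P ℕ.+ length Q ≤ fuel → Reduction P Q
  reduce fuel [] Q _ = reduction-0 Q
  reduce fuel P@(_ ∷ _) [] _ = reduction-sym (reduction-0 P)
  reduce (suc fuel) (a ∷ P) (b ∷ Q) (s≤s bound) with a ℚ.≟ 0ℚ | b ℚ.≟ 0ℚ
  ... | yes ≡.refl | yes ≡.refl =
    reduction-cong (q*≈0∷ P) (q*≈0∷ Q) (reduction-scale q (reduce fuel P Q
      (ℕ.≤-trans (ℕ.+-monoʳ-≤ (length P) (ℕ.n≤1+n (length Q))) bound)))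
  ... | yes ≡.refl | no b≢0 =
    reduction-cong (q*≈0∷ P) refl (reduction-q b≢0 (reduce fuel P (b ∷ Q) bound))
  ... | no a≢0 | yes ≡.refl =
    reduction-cong refl (q*≈0∷ Q) (reduction-sym (reduction-q a≢0 (reduction-sym
      (reduce fuel (a ∷ P) Q (≡.subst (_≤ fuel) (ℕ.+-suc (length P) (length Q)) bound)))))
  ... | no a≢0 | no b≢0 with ℕ.≤-total (length Q) (length P)
  ...   | inj₁ Q≤P = cancel-constants a P b Q b≢0 (reduce fuel (P Poly.+ Poly.scale c Q) (b ∷ Q)
    (≡.subst (λ l → l ℕ.+ suc (length Q) ≤ fuel) (≡.sym (length-+-scale P c Q Q≤P)) bound))
    where
    instance _ = ℚ.≢-nonZero b≢0
    c = ℚ.- (a ℚ.* ℚ.1/ b)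
  ...   | inj₂ P≤Q = reduction-sym (cancel-constants b Q a P a≢0
    (reduce fuel (Q Poly.+ Poly.scale c P) (a ∷ P)
      (≡.subst (λ l → l ℕ.+ suc (length P) ≤ fuel) (≡.sym (length-+-scale Q c P P≤Q))
        (≡.subst (_≤ fuel) (≡.trans (ℕ.+-suc (length P) (length Q))
          (≡.trans (≡.cong suc (ℕ.+-comm (length P) (length Q))) (≡.sym (ℕ.+-suc (length Q) (length P)))))
          bound))))
    where
    instance _ = ℚ.≢-nonZero a≢0
    c = ℚ.- (b ℚ.* ℚ.1/ a)

  -- The cancelled factor is returned as well: facts about the original numerator and denominator
  -- reach the reduced ones through it.
  lowestTerms : ∀ A → ∃[ F ] F IsLowestTermsOf A ×
    ∃[ g ] num A ≈ g Poly.* num F × den A ≈ g Poly.* den F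
  lowestTerms A = F , record { equal = RF.cross equal ; reduced = reduced } , common , a≈ , b≈
    where
    open SetoidReasoning (CommutativeRing.setoid polyRing)
    open IntegerCoefficients polyRing
    open CommutativeRing polyRing using (zeroʳ; *-congʳ)
    open Reduction (reduce _ (num A) (den A) ℕ.≤-refl)
    F : RatFun
    F = a′ over b′ ⟨ (λ b′≈0 → den≉0 A (trans b≈ (trans (*-congˡ {common} b′≈0) (zeroʳ common)))) ⟩
    equal : num A Poly.* b′ ≈ a′ Poly.* den A
    equal = begin
      num A Poly.* b′                ≈⟨ *-congʳ {b′} a≈ ⟩
      common Poly.* a′ Poly.* b′
        ≈⟨ solve 3 (λ g a b → g :* a :* b := a :* (g :* b)) refl common a′ b′ ⟩
      a′ Poly.* (common Poly.* b′)   ≈⟨ *-congˡ {a′} b≈ ⟨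
      a′ Poly.* den A                ∎
    reduced : Poly.Coprime a′ b′
    reduced {z} (s , sz≈a′) (t , tz≈b′) = u Poly.* s Poly.+ v Poly.* t , (begin
      (u Poly.* s Poly.+ v Poly.* t) Poly.* z
        ≈⟨ solve 5 (λ u s v t z → (u :* s :+ v :* t) :* z := u :* (s :* z) :+ v :* (t :* z)) refl u s v t z ⟩
      u Poly.* (s Poly.* z) Poly.+ v Poly.* (t Poly.* z)
        ≈⟨ +-cong (*-congˡ {u} sz≈a′) (*-congˡ {v} tz≈b′) ⟩
      u Poly.* a′ Poly.+ v Poly.* b′ ≈⟨ bézout ⟩
      Poly.1# ∎)

open LowestTerms using (lowestTerms; constants-multiply)

-- The Legendre symbol of -1

module SquareRootsOfMinusOne where

  open ≡ using (refl; sym; trans; cong; cong₂; subst)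

  module ℕΣ = MonoidSum ℕ.+-0-commutativeMonoid

  module Involution {n : ℕ} (f : Fin n → Fin n) (f∘f : ∀ i → f (f i) ≡ i) where

    -- `ascent` marks the smaller element of every 2-cycle.
    ascent fixed : Fin n → ℕ
    ascent i with Fin.<-cmp i (f i)
    ... | tri< _ _ _ = 1
    ... | tri≈ _ _ _ = 0
    ... | tri> _ _ _ = 0
    fixed i with i Fin.≟ f i
    ... | yes _ = 1
    ... | no  _ = 0

    ascents+fixed : ∀ i → 1 ≡ ascent i ℕ.+ ascent (f i) ℕ.+ fixed i
    ascents+fixed i with i Fin.≟ f i | Fin.<-cmp i (f i) | Fin.<-cmp (f i) (f (f i))
    ... | yes e  | tri< _ ¬e _ | _          = contradiction e ¬e
    ... | yes e  | tri> _ ¬e _ | _          = contradiction e ¬e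
    ... | yes e  | tri≈ _ _ _  | tri< _ ¬e′ _ = contradiction (cong f e) ¬e′
    ... | yes _  | tri≈ _ _ _  | tri≈ _ _ _ = refl
    ... | yes _  | tri≈ _ _ _  | tri> _ _ _ = refl
    ... | no ¬e  | tri≈ _ e _  | _          = contradiction e ¬e
    ... | no _   | tri< l _ _  | tri< l′ _ _ =
      contradiction (subst (f i Fin.<_) (f∘f i) l′) (ℕ.<-asym l)
    ... | no _   | tri< _ _ _  | tri≈ _ _ _ = refl
    ... | no _   | tri< _ _ _  | tri> _ _ _ = refl
    ... | no _   | tri> _ _ _  | tri< _ _ _ = refl
    ... | no ¬e  | tri> _ _ _  | tri≈ _ e _ = contradiction (sym (trans e (f∘f i))) ¬e
    ... | no _   | tri> _ _ l  | tri> _ _ l′ =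
      contradiction (subst (Fin._< f i) (f∘f i) l′) (ℕ.<-asym l)

    -- Every element is the smaller or the larger one of a 2-cycle or is fixed. Since `f` is a
    -- permutation, `ascent ∘ f` has the same sum as `ascent`.
    parity : n ≡ 2 ℕ.* ℕΣ.sum ascent ℕ.+ ℕΣ.sum fixed
    parity = begin
      n                                            ≡⟨ n≡∑1 n ⟩
      ℕΣ.sum {n} (λ _ → 1)                         ≡⟨ ℕΣ.sum-cong-≗ {n} {λ _ → 1} ascents+fixed ⟩
      ℕΣ.sum (λ i → ascent i ℕ.+ ascent (f i) ℕ.+ fixed i)
        ≡⟨ ℕΣ.∑-distrib-+ (λ i → ascent i ℕ.+ ascent (f i)) fixed ⟩
      ℕΣ.sum (λ i → ascent i ℕ.+ ascent (f i)) ℕ.+ ℕΣ.sum fixed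
        ≡⟨ cong (ℕ._+ ℕΣ.sum fixed) (ℕΣ.∑-distrib-+ ascent (ascent ∘ f)) ⟩
      ℕΣ.sum ascent ℕ.+ ℕΣ.sum (ascent ∘ f) ℕ.+ ℕΣ.sum fixed
        ≡⟨ cong (λ s → ℕΣ.sum ascent ℕ.+ s ℕ.+ ℕΣ.sum fixed) (ℕΣ.sum-permute ascent π) ⟨
      ℕΣ.sum ascent ℕ.+ ℕΣ.sum ascent ℕ.+ ℕΣ.sum fixed
        ≡⟨ cong (λ s → ℕΣ.sum ascent ℕ.+ s ℕ.+ ℕΣ.sum fixed) (ℕ.+-identityʳ (ℕΣ.sum ascent)) ⟨
      2 ℕ.* ℕΣ.sum ascent ℕ.+ ℕΣ.sum fixed         ∎
      where
      open ≡.≡-Reasoning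
      π : Permutation′ n
      π = permutation f f f∘f f∘f
      n≡∑1 : ∀ n → n ≡ ℕΣ.sum {n} (λ _ → 1)
      n≡∑1 zero    = refl
      n≡∑1 (suc n) = cong suc (n≡∑1 n)

  sum-zero : ∀ {n} {f : Fin n → ℕ} → (∀ i → f i ≡ 0) → ℕΣ.sum f ≡ 0
  sum-zero {n} {f} f≡0 = trans (ℕΣ.sum-cong-≗ {n} {f} {λ _ → 0} f≡0) (ℕΣ.sum-replicate-zero n)

  fixedPointFree⇒even : ∀ {n} (f : Fin n → Fin n) → (∀ i → f (f i) ≡ i) → (∀ i → i ≢ f i) →
                        ∃[ m ] n ≡ 2 ℕ.* m
  fixedPointFree⇒even f f∘f i≢fi = ℕΣ.sum ascent ,
    trans parity (trans (cong (2 ℕ.* ℕΣ.sum ascent ℕ.+_) (sum-zero {f = fixed} fixed≡0)) (ℕ.+-identityʳ _))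
    where
    open Involution f f∘f
    fixed≡0 : ∀ i → fixed i ≡ 0
    fixed≡0 i with i Fin.≟ f i
    ... | yes e = contradiction e (i≢fi i)
    ... | no  _ = refl

  onlyZeroFixed⇒odd : ∀ {n} (f : Fin (suc n) → Fin (suc n)) → (∀ i → f (f i) ≡ i) →
    zero ≡ f zero → (∀ i → i ≡ f i → i ≡ zero) → ∃[ m ] suc n ≡ suc (2 ℕ.* m)
  onlyZeroFixed⇒odd {n} f f∘f f0 unique = ℕΣ.sum ascent ,
    trans parity (trans (cong (2 ℕ.* ℕΣ.sum ascent ℕ.+_) fixed≡1) (ℕ.+-comm (2 ℕ.* ℕΣ.sum ascent) 1))
    where
    open Involution f f∘f
    fixed-suc : ∀ i → fixed (suc i) ≡ 0
    fixed-suc i with suc i Fin.≟ f (suc i)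
    ... | yes e = contradiction (sym (unique (suc i) e)) Fin.0≢1+n
    ... | no  _ = refl
    fixed-zero : fixed zero ≡ 1
    fixed-zero with zero Fin.≟ f zero
    ... | yes _ = refl
    ... | no ¬e = contradiction f0 ¬e
    fixed≡1 : ℕΣ.sum fixed ≡ 1
    fixed≡1 = cong₂ ℕ._+_ fixed-zero (sum-zero {f = fixed ∘ suc} fixed-suc)

  -- Unfolds `legendre` along its two decisions, the first of which is settled by the hypothesis.
  legendre-dichotomy : ∀ p → ¬ (+ p ∣ℤ -1ℤ) →
    ((∃[ x ] + p ∣ℤ (+ toℕ {p} x ℤ.* + toℕ x ℤ.- -1ℤ)) × legendre -1ℤ p ≡ 1ℤ) ⊎
    ((∀ (x : Fin p) → ¬ (+ p ∣ℤ (+ toℕ x ℤ.* + toℕ x ℤ.- -1ℤ))) × legendre -1ℤ p ≡ -1ℤ)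
  legendre-dichotomy p p∤-1
    rewrite dec-false (+ p ∣ℤ? -1ℤ) p∤-1
    with Fin.any? {n = p} (λ x → + p ∣ℤ? (+ toℕ x ℤ.* + toℕ x ℤ.- -1ℤ))
  ... | yes root  = inj₁ (root , refl)
  ... | no noRoot = inj₂ ((λ x d → noRoot (x , d)) , refl)

  module RepresentativesUpToSign {c ℓ} (R : CommutativeRing c ℓ) where

    open CommutativeRing R using (Carrier; _≈_; _≉_; _+_; _*_; -_; 0#; 1#; setoid)
    private module R = CommutativeRing R
    open SetoidReasoning setoid
    open IntegerCoefficients R

    infix 4 _~_

    -- In an integral domain, equality up to sign.
    _~_ : Carrier → Carrier → Set ℓ
    a ~ b = a * a ≈ b * b

    -⇒~ : ∀ {a b} → a ≈ - b → a ~ b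
    -⇒~ {a} {b} a≈-b = R.trans (R.*-cong a≈-b a≈-b) (solve 1 (λ b → (:- b) :* (:- b) := b :* b) R.refl b)

    *-~ : ∀ c {a b} → a ~ b → c * a ~ c * b
    *-~ c {a} {b} a~b = begin
      c * a * (c * a)  ≈⟨ solve 2 (λ c a → c :* a :* (c :* a) := c :* c :* (a :* a)) R.refl c a ⟩
      c * c * (a * a)  ≈⟨ R.*-congˡ a~b ⟩
      c * c * (b * b)  ≈⟨ solve 2 (λ c a → c :* a :* (c :* a) := c :* c :* (a :* a)) R.refl c b ⟨
      c * b * (c * b)  ∎

    module Domain (domain : ∀ a b → a * b ≈ 0# → a ≈ 0# ⊎ b ≈ 0#) where

      ≉0-* : ∀ {a b} → a ≉ 0# → b ≉ 0# → a * b ≉ 0#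
      ≉0-* {a} {b} a≉0 b≉0 ab≈0 = Sum.[ a≉0 , b≉0 ] (domain a b ab≈0)

      -≈0⇒≈ : ∀ {a b} → a + - b ≈ 0# → a ≈ b
      -≈0⇒≈ {a} {b} e = begin
        a            ≈⟨ solve 2 (λ a b → a := a :- b :+ b) R.refl a b ⟩
        a + - b + b  ≈⟨ R.+-congʳ e ⟩
        0# + b       ≈⟨ R.+-identityˡ b ⟩
        b            ∎

      ≈⇒-≈0 : ∀ {a b} → a ≈ b → a + - b ≈ 0#
      ≈⇒-≈0 {a} {b} a≈b = R.trans (R.+-congʳ a≈b) (R.-‿inverseʳ b)

      ~⇒± : ∀ {a b} → a ~ b → a ≈ b ⊎ a ≈ - b
      ~⇒± {a} {b} a~b = Sum.map -≈0⇒≈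
        (λ e → -≈0⇒≈ (R.trans (solve 2 (λ a b → a :- (:- b) := a :+ b) R.refl a b) e))
        (domain (a + - b) (a + b) (R.trans
          (solve 2 (λ a b → (a :- b) :* (a :+ b) := a :* a :- b :* b) R.refl a b) (≈⇒-≈0 a~b)))

      ~-cancelˡ : ∀ c {a b} → c ≉ 0# → c * a ~ c * b → a ~ b
      ~-cancelˡ c {a} {b} c≉0 ca~cb with domain (c * c) (a * a + - (b * b)) (R.trans
        (solve 3 (λ a b c → c :* c :* (a :* a :- b :* b) := c :* a :* (c :* a) :- c :* b :* (c :* b))
          R.refl a b c) (≈⇒-≈0 ca~cb))
      ... | inj₁ c²≈0 = contradiction c²≈0 (≉0-* c≉0 c≉0)
      ... | inj₂ e    = -≈0⇒≈ e

      -- `rep` lists one element from each nonzero class up to sign; index `zero` is the class of 1.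
      module Representatives {n : ℕ} (rep : Fin (suc n) → Carrier)
        (1≉0 : 1# ≉ 0#) (2≉0 : 1# + 1# ≉ 0#)
        (rep-zero : rep zero ≈ 1#)
        (rep≉0 : ∀ i → rep i ≉ 0#)
        (rep-injective : ∀ i j → rep i ~ rep j → i ≡ j)
        (represent : ∀ a → a ≉ 0# → ∃[ i ] rep i ~ a)
        (inverse : ∀ i → ∃[ b ] rep i * b ~ 1#)
        where

        root⇒≉0 : ∀ {a} → a * a ≈ - 1# → a ≉ 0#
        root⇒≉0 {a} a²≈-1 a≈0 = 1≉0 (begin
          1#            ≈⟨ solve 0 (con 1ℤ := :- (:- con 1ℤ)) R.refl ⟩
          - - 1#        ≈⟨ R.-‿cong a²≈-1 ⟨
          - (a * a)     ≈⟨ R.-‿cong (R.*-congʳ a≈0) ⟩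
          - (0# * a)    ≈⟨ solve 1 (λ a → :- (con 0ℤ :* a) := con 0ℤ) R.refl a ⟩
          0#            ∎)

        -- If a² = -1 then x ↦ ax is an involution up to sign, and it has no fixed point.
        root⇒even : ∀ a → a * a ≈ - 1# → ∃[ m ] suc n ≡ 2 ℕ.* m
        root⇒even a a²≈-1 = fixedPointFree⇒even f f∘f i≢fi
          where
          ar≉0 : ∀ i → a * rep i ≉ 0#
          ar≉0 i = ≉0-* (root⇒≉0 a²≈-1) (rep≉0 i)
          f : Fin (suc n) → Fin (suc n)
          f i = proj₁ (represent (a * rep i) (ar≉0 i))
          rep-f : ∀ i → rep (f i) ~ a * rep i
          rep-f i = proj₂ (represent (a * rep i) (ar≉0 i))
          f∘f : ∀ i → f (f i) ≡ i
          f∘f i = rep-injective (f (f i)) i (begin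
            rep (f (f i)) * rep (f (f i))          ≈⟨ rep-f (f i) ⟩
            a * rep (f i) * (a * rep (f i))        ≈⟨ *-~ a (rep-f i) ⟩
            a * (a * rep i) * (a * (a * rep i))
              ≈⟨ solve 2 (λ a r → a :* (a :* r) :* (a :* (a :* r)) := a :* a :* (a :* a) :* (r :* r))
                   R.refl a (rep i) ⟩
            a * a * (a * a) * (rep i * rep i)      ≈⟨ R.*-congʳ (R.*-cong a²≈-1 a²≈-1) ⟩
            - 1# * - 1# * (rep i * rep i)
              ≈⟨ solve 1 (λ r → (:- con 1ℤ) :* (:- con 1ℤ) :* r := r) R.refl (rep i * rep i) ⟩
            rep i * rep i                          ∎)
          i≢fi : ∀ i → i ≢ f i
          -- A fixed point would give r² = a²r² = -r², hence 2r² = 0.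
          i≢fi i i≡fi = ≉0-* 2≉0 (≉0-* (rep≉0 i) (rep≉0 i)) (begin
            (1# + 1#) * (r * r)
              ≈⟨ solve 1 (λ s → (con 1ℤ :+ con 1ℤ) :* s := s :- (:- con 1ℤ) :* s) R.refl (r * r) ⟩
            r * r + - (- 1# * (r * r))             ≈⟨ R.+-congˡ (R.-‿cong (R.*-congʳ a²≈-1)) ⟨
            r * r + - (a * a * (r * r))
              ≈⟨ solve 2 (λ a r → r :* r :- a :* a :* (r :* r) := r :* r :- a :* r :* (a :* r)) R.refl a r ⟩
            r * r + - (a * r * (a * r))            ≈⟨ ≈⇒-≈0 (subst (λ j → rep j ~ a * r) (sym i≡fi) (rep-f i)) ⟩
            0#                                     ∎)
            where r = rep i

        inverse≉0 : ∀ {r b} → r * b ~ 1# → b ≉ 0#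
        inverse≉0 {r} {b} rb~1 b≈0 = 1≉0 (begin
          1#                     ≈⟨ R.*-identityˡ 1# ⟨
          1# * 1#                ≈⟨ rb~1 ⟨
          r * b * (r * b)        ≈⟨ R.*-congˡ (R.*-congˡ b≈0) ⟩
          r * b * (r * 0#)
            ≈⟨ solve 2 (λ x r → x :* (r :* con 0ℤ) := con 0ℤ) R.refl (r * b) r ⟩
          0#                     ∎)

        partner : ∀ i → ∃[ j ] rep i * rep j ~ 1#
        partner i with inverse i
        ... | b , rb~1 with represent b (inverse≉0 {rep i} {b} rb~1)
        ...   | j , rep-j~b = j , R.trans (*-~ (rep i) {rep j} {b} rep-j~b) rb~1

        -- Up to sign, the fixed points of x ↦ 1/x are 1 and the square roots of -1.
        module _ (noRoot : ∀ i → rep i * rep i ≉ - 1#)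
          (f : Fin (suc n) → Fin (suc n)) (r*rf~1 : ∀ i → rep i * rep (f i) ~ 1#) where

          inverse-involutive : ∀ i → f (f i) ≡ i
          inverse-involutive i = rep-injective (f (f i)) i
            (~-cancelˡ (rep (f i)) {rep (f (f i))} {rep i} (rep≉0 (f i)) (R.trans (r*rf~1 (f i))
              (R.sym (R.trans (R.*-cong fi*i fi*i) (r*rf~1 i)))))
            where
            fi*i : rep (f i) * rep i ≈ rep i * rep (f i)
            fi*i = R.*-comm (rep (f i)) (rep i)

          rep-zero*x : ∀ x → rep zero * x ≈ x
          rep-zero*x x = R.trans (R.*-congʳ rep-zero) (R.*-identityˡ x)

          inverse-zero : zero ≡ f zero
          inverse-zero = rep-injective zero (f zero) (R.trans (R.*-cong rep-zero rep-zero)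
            (R.trans (R.sym (r*rf~1 zero))
              (R.*-cong (rep-zero*x (rep (f zero))) (rep-zero*x (rep (f zero))))))

          inverse-fixed : ∀ i → i ≡ f i → i ≡ zero
          inverse-fixed i i≡fi
            -- A fixed class satisfies r⁴ = 1, so r² is 1 or -1.
            with ~⇒± {rep i * rep i} {1#} (subst (λ j → rep i * rep j ~ 1#) (sym i≡fi) (r*rf~1 i))
          ... | inj₂ r²≈-1 = contradiction r²≈-1 (noRoot i)
          ... | inj₁ r²≈1  = rep-injective i zero (R.trans r²≈1
            (R.sym (R.trans (rep-zero*x (rep zero)) rep-zero)))

          noRoot-odd : ∃[ m ] suc n ≡ suc (2 ℕ.* m)
          noRoot-odd = onlyZeroFixed⇒odd f inverse-involutive inverse-zero inverse-fixed

        noRoot⇒odd : (∀ i → rep i * rep i ≉ - 1#) → ∃[ m ] suc n ≡ suc (2 ℕ.* m)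
        noRoot⇒odd noRoot = noRoot-odd noRoot (proj₁ ∘ partner) (proj₂ ∘ partner)

  -- Here (p - 1)/2 is `suc n`, so that the class of 1 has an index. The representatives are 1, ...,
  -- (p - 1)/2.
  module MinusOne (n p : ℕ) (p≡ : p ≡ suc (2 ℕ.* suc n)) (p-prime : Prime p) where

    private instance _ = prime⇒nonZero p-prime

    open QuotientRing ℤ.+-*-commutativeRing (+ p)
    module ℤₚ = CommutativeRing quotientRing
    open RepresentativesUpToSign quotientRing using (_~_; -⇒~; module Domain)

    ∣⇒≈ : ∀ {a b} → + p ∣ℤ (a ℤ.- b) → a ≈ₘ b
    ∣⇒≈ (ℤ∣.divides k e) = difference⇒≈ₘ k e

    ≈⇒∣ : ∀ {a b} → a ≈ₘ b → + p ∣ℤ (a ℤ.- b)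
    ≈⇒∣ e = ℤ∣.divides (_≈ₘ_.multiple e) (≈ₘ⇒difference e)

    ∣⇒≈0 : ∀ {a} → + p ∣ℤ a → a ≈ₘ 0ℤ
    ∣⇒≈0 {a} p∣a = ∣⇒≈ (subst (+ p ∣ℤ_) (sym (ℤ.+-identityʳ a)) p∣a)

    ≈0⇒∣ : ∀ {a} → a ≈ₘ 0ℤ → + p ∣ℤ a
    ≈0⇒∣ {a} a≈0 = subst (+ p ∣ℤ_) (ℤ.+-identityʳ a) (≈⇒∣ a≈0)

    domain : ∀ a b → a ℤ.* b ≈ₘ 0ℤ → a ≈ₘ 0ℤ ⊎ b ≈ₘ 0ℤ
    domain a b ab≈0 = Sum.map (∣⇒≈0 ∘ ℤ∣.∣ᵤ⇒∣) (∣⇒≈0 ∘ ℤ∣.∣ᵤ⇒∣)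
      (euclidsLemma ℤ.∣ a ∣ ℤ.∣ b ∣ p-prime (subst (p ℕ∣.∣_) (ℤ.abs-* a b) (ℤ∣.∣⇒∣ᵤ (≈0⇒∣ ab≈0))))

    small≉0 : ∀ {k} → suc k < p → ¬ (+ suc k ≈ₘ 0ℤ)
    small≉0 k<p k≈0 = ℕ.<⇒≱ k<p (ℕ∣.∣⇒≤ (ℤ∣.∣⇒∣ᵤ (≈0⇒∣ k≈0)))

    <p : ∀ {k} → k ≤ 2 ℕ.* suc n → k < p
    <p k≤2n = subst (_ <_) (sym p≡) (s≤s k≤2n)

    rep : Fin (suc n) → ℤ
    rep i = + suc (toℕ i)

    rep≤ : (i : Fin (suc n)) → suc (toℕ i) ≤ suc n
    rep≤ i = Fin.toℕ<n i

    rep<p : ∀ i → suc (toℕ i) < p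
    rep<p i = <p (ℕ.≤-trans (rep≤ i) (ℕ.m≤m+n (suc n) _))

    2≤2*1+n : 2 ≤ 2 ℕ.* suc n
    2≤2*1+n = ℕ.*-monoʳ-≤ 2 (s≤s (z≤n {n}))

    open Domain domain

    ≈⇒≡ : ∀ {a b} → a ≤ b → b < p → + a ≈ₘ + b → a ≡ b
    ≈⇒≡ {a} a≤b b<p a≈b with ℕ.m≤n⇒∃[o]m+o≡n a≤b
    ... | zero  , refl = sym (ℕ.+-identityʳ a)
    ... | suc k , refl = contradiction
      (ℤₚ.trans (fromEq (sym (trans (cong (ℤ._- + a) (ℤ.+-comm (+ a) (+ suc k)))
                                   (trans (ℤ.+-assoc (+ suc k) (+ a) (ℤ.- + a))
                                          (trans (cong (λ x → + suc k ℤ.+ x) (ℤ.+-inverseʳ (+ a)))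
                                                 (ℤ.+-identityʳ (+ suc k)))))))
                (≈⇒-≈0 {+ (a ℕ.+ suc k)} {+ a} (ℤₚ.sym a≈b)))
      (small≉0 (ℕ.≤-trans (s≤s (ℕ.m≤n+m (suc k) a)) b<p))

    rep≈⇒≡ : ∀ i j → rep i ≈ₘ rep j → i ≡ j
    rep≈⇒≡ i j i≈j with ℕ.≤-total (suc (toℕ i)) (suc (toℕ j))
    ... | inj₁ i≤j = Fin.toℕ-injective (ℕ.suc-injective (≈⇒≡ i≤j (rep<p j) i≈j))
    ... | inj₂ j≤i = sym (Fin.toℕ-injective (ℕ.suc-injective (≈⇒≡ j≤i (rep<p i) (ℤₚ.sym i≈j))))

    -- The sum of two representatives is positive and at most p - 1.
    rep≉-rep : ∀ i j → ¬ (rep i ≈ₘ ℤ.- rep j)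
    rep≉-rep i j i≈-j = small≉0 {toℕ i ℕ.+ suc (toℕ j)}
      (<p (subst (suc (toℕ i) ℕ.+ suc (toℕ j) ≤_)
        (cong (suc n ℕ.+_) (sym (ℕ.+-identityʳ (suc n)))) (ℕ.+-mono-≤ (rep≤ i) (rep≤ j))))
      (ℤₚ.trans {rep i ℤ.+ rep j} {ℤ.- rep j ℤ.+ rep j} {0ℤ}
        (ℤₚ.+-congʳ {rep j} {rep i} {ℤ.- rep j} i≈-j) (ℤₚ.-‿inverseˡ (rep j)))

    rep-injective : ∀ i j → rep i ~ rep j → i ≡ j
    rep-injective i j i~j =
      Sum.[ rep≈⇒≡ i j , (λ i≈-j → contradiction i≈-j (rep≉-rep i j)) ] (~⇒± {rep i} {rep j} i~j)

    ~-cong : ∀ {a b} → a ≈ₘ b → a ~ b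
    ~-cong a≈b = ℤₚ.*-cong a≈b a≈b

    represent-ℕ : ∀ t → t < p → ¬ (+ t ≈ₘ 0ℤ) → ∃[ i ] rep i ~ + t
    represent-ℕ zero    _   t≉0 = contradiction ℤₚ.refl t≉0
    represent-ℕ (suc t) t<p _ with suc t ℕ.≤? suc n
    ... | yes t<n = fromℕ< t<n , ~-cong (ℤₚ.reflexive (cong (+_ ∘ suc) (Fin.toℕ-fromℕ< t<n)))
    -- Past the middle the class of t + 1 is represented by its negative p - (t + 1) = u + 1.
    ... | no  t≮n with ℕ.m≤n⇒∃[o]m+o≡n t<p
    ...   | u , t+u≡p = fromℕ< u<n , -⇒~ {b = + suc t} (ℤₚ.trans
      (ℤₚ.reflexive (cong (+_ ∘ suc) (Fin.toℕ-fromℕ< u<n))) (∣⇒≈ (ℤ∣.divides 1ℤ (begin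
        + suc u ℤ.- (ℤ.- + suc t)  ≡⟨ cong (λ x → + suc u ℤ.+ x) (ℤ.neg-involutive (+ suc t)) ⟩
        + (suc u ℕ.+ suc t)        ≡⟨ cong +_ (trans (ℕ.+-comm (suc u) (suc t))
                                                     (trans (ℕ.+-suc (suc t) u) t+u≡p)) ⟩
        + p                        ≡⟨ ℤ.*-identityˡ (+ p) ⟨
        1ℤ ℤ.* + p                 ∎))))
      where
      open ≡.≡-Reasoning
      u<n : u < suc n
      u<n = ℕ.+-cancelˡ-≤ (suc n) (suc u) (suc n) (ℕ.s≤s⁻¹ (ℕ.≤-trans
        (ℕ.+-monoˡ-≤ (suc u) (ℕ.≰⇒> t≮n))
        (ℕ.≤-reflexive (trans (trans (trans (ℕ.+-suc (suc t) u) t+u≡p) p≡)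
          (cong (λ m → suc (suc n ℕ.+ m)) (ℕ.+-identityʳ (suc n)))))))

    represent : ∀ a → ¬ (a ≈ₘ 0ℤ) → ∃[ i ] rep i ~ a
    represent a a≉0 =
      let i , e = represent-ℕ (a ℤ.%ℕ p) (ℤ.n%ℕd<d a p) (λ t≈0 → a≉0 (ℤₚ.trans a≈t t≈0))
      in i , ℤₚ.trans e (~-cong (ℤₚ.sym a≈t))
      where
      a≈t : a ≈ₘ + (a ℤ.%ℕ p)
      a≈t = (a ℤ./ℕ p) QuotientRing., ℤ.a≡a%ℕn+[a/ℕn]*n a p

    inverse-ℕ : ∀ r → Bézout.Identity 1 p r → ∃[ b ] + r ℤ.* b ~ 1ℤ
    inverse-ℕ r (Bézout.-+ a b 1+ap≡br) = + b , ~-cong {+ r ℤ.* + b} {1ℤ} ((+ a) QuotientRing., (begin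
      + r ℤ.* + b              ≡⟨ ℤ.*-comm (+ r) (+ b) ⟩
      + b ℤ.* + r              ≡⟨ ℤ.pos-* b r ⟨
      + (b ℕ.* r)              ≡⟨ cong +_ 1+ap≡br ⟨
      1ℤ ℤ.+ + (a ℕ.* p)       ≡⟨ cong (λ x → 1ℤ ℤ.+ x) (ℤ.pos-* a p) ⟩
      1ℤ ℤ.+ + a ℤ.* + p       ∎))
      where open ≡.≡-Reasoning
    -- This Bézout form makes the product -1 modulo p, which is as good as 1 up to sign.
    inverse-ℕ r (Bézout.+- a b 1+br≡ap) = + b , -⇒~ {+ r ℤ.* + b} {1ℤ} (∣⇒≈ (ℤ∣.divides (+ a) (begin
      + r ℤ.* + b ℤ.+ 1ℤ       ≡⟨ cong (ℤ._+ 1ℤ) (ℤ.*-comm (+ r) (+ b)) ⟩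
      + b ℤ.* + r ℤ.+ 1ℤ       ≡⟨ cong (ℤ._+ 1ℤ) (ℤ.pos-* b r) ⟨
      + (b ℕ.* r) ℤ.+ 1ℤ       ≡⟨ ℤ.+-comm (+ (b ℕ.* r)) 1ℤ ⟩
      + suc (b ℕ.* r)          ≡⟨ cong +_ 1+br≡ap ⟩
      + (a ℕ.* p)              ≡⟨ ℤ.pos-* a p ⟩
      + a ℤ.* + p              ∎)))
      where open ≡.≡-Reasoning

    inverse : ∀ i → ∃[ b ] rep i ℤ.* b ~ 1ℤ
    inverse i = inverse-ℕ (suc (toℕ i)) (coprime-Bézout (prime⇒coprime p-prime (rep<p i)))

    1≉0ₚ : ¬ (1ℤ ≈ₘ 0ℤ)
    1≉0ₚ = small≉0 (<p (ℕ.<⇒≤ 2≤2*1+n))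

    open Representatives rep 1≉0ₚ (small≉0 (<p 2≤2*1+n)) ℤₚ.refl (λ i → small≉0 (rep<p i))
      rep-injective represent inverse

    legendre-minusOne : (∃[ m ] suc n ≡ 2 ℕ.* m × legendre -1ℤ p ≡ 1ℤ) ⊎
                        (∃[ m ] suc n ≡ suc (2 ℕ.* m) × legendre -1ℤ p ≡ -1ℤ)
    legendre-minusOne with legendre-dichotomy p (λ p∣-1 → 1≉0ₚ (∣⇒≈0 (ℤ∣.∣m⇒∣-m p∣-1)))
    ... | inj₁ ((x , x²≡-1) , leg) =
      let m , e = root⇒even (+ toℕ x) (∣⇒≈ x²≡-1) in inj₁ (m , e , leg)
    ... | inj₂ (noRoot , leg) =
      let m , e = noRoot⇒odd (λ i r²≈-1 → noRoot (fromℕ< (rep<p i))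
                    (subst (λ x → + p ∣ℤ (+ x ℤ.* + x ℤ.- -1ℤ)) (sym (Fin.toℕ-fromℕ< (rep<p i)))
                           (≈⇒∣ r²≈-1)))
      in inj₂ (m , e , leg)

open SquareRootsOfMinusOne using (module MinusOne)

-- Residues of fractions and the congruence relation

module Evaluation (m : Poly) where

  open QuotientRing polyRing m
  open CommutativeRing quotientRing using (semiring; trans; sym; *-congʳ; -‿inverseʳ; zeroˡ)
  open SemiringSum semiring using () renaming (sum to sumₘ)
  open Units quotientRing using (Unit; unit-1; unit-*)
  open FractionValues quotientRing

  -- The residue of a fraction, stated without inverting its denominator and therefore stable under
  -- the unreduced sums of `RF`.
  Value : RatFun → Poly → Set
  Value A x = num A ≈ₘ x Poly.* den A

  sum-value : ∀ {n} (f : Fin n → RatFun) (x : Fin n → Poly) → (∀ i → Value (f i) (x i)) →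
              Value (RF.sum f) (sumₘ x)
  sum-value {zero}  f x v = sym (zeroˡ Poly.1#)
  sum-value {suc n} f x v =
    value-+ {num (f zero)} {num (RF.sum (f ∘ suc))} {x zero} {sumₘ (x ∘ suc)}
            {den (f zero)} {den (RF.sum (f ∘ suc))}
            (v zero) (sum-value (f ∘ suc) (x ∘ suc) (v ∘ suc))

  sum-unit : ∀ {n} (f : Fin n → RatFun) → (∀ i → Unit (den (f i))) → Unit (den (RF.sum f))
  sum-unit {zero}  f u = unit-1
  sum-unit {suc n} f u = unit-* {den (f zero)} {den (RF.sum (f ∘ suc))}
                                (u zero) (sum-unit (f ∘ suc) (u ∘ suc))

  difference-value : ∀ A B x → Value A x → Value B x → num (A RF.- B) ≈ₘ Poly.0#
  difference-value A B x a b = trans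
    (value-+ {num A} {Poly.- num B} {x} {Poly.- x} {den A} {den B} a
      (value-neg {num B} {x} {den B} b))
    (trans (*-congʳ {den A Poly.* den B} (-‿inverseʳ x)) (zeroˡ (den A Poly.* den B)))

module Congruence (w : Poly) where

  open CommutativeRing polyRing hiding (zero)
  open SetoidReasoning setoid
  open IntegerCoefficients polyRing
  open SquareQuotient polyRing w using (module R/w; module R/w²; unit-lift)
  open Units R/w.quotientRing using ()
    renaming (Unit to Unitʷ; unit-cong to unit-congʷ; unit-factor to unit-factorʷ; unit-* to unit-*ʷ)
  open Units R/w².quotientRing using () renaming (unit-cancel to unit-cancelʷ²)
  open Evaluation (w Poly.^ 2) using (Value; difference-value)

  open import Algebra.Definitions.RawMagma using (_,_)

  -- An inverse u of d modulo w gives the Bézout identity ud - kw = 1.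
  unit⇒coprime : ∀ {d} → Unitʷ d → Poly.Coprime d w
  unit⇒coprime {d} (u , (k R/w., ud≈1+kw)) {z} (s , sz≈d) (t , tz≈w) =
    u Poly.* s Poly.+ Poly.- (k Poly.* t) , (begin
    (u Poly.* s Poly.+ Poly.- (k Poly.* t)) Poly.* z
      ≈⟨ solve 5 (λ u s k t z → (u :* s :+ :- (k :* t)) :* z := u :* (s :* z) :- k :* (t :* z))
           refl u s k t z ⟩
    u Poly.* (s Poly.* z) Poly.+ Poly.- (k Poly.* (t Poly.* z))
      ≈⟨ +-cong (*-congˡ {u} sz≈d) (-‿cong (*-congˡ {k} tz≈w)) ⟩
    u Poly.* d Poly.+ Poly.- (k Poly.* w)
      ≈⟨ +-congʳ {Poly.- (k Poly.* w)} ud≈1+kw ⟩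
    Poly.1# Poly.+ k Poly.* w Poly.+ Poly.- (k Poly.* w)
      ≈⟨ solve 1 (λ x → con 1ℤ :+ x :- x := con 1ℤ) refl (k Poly.* w) ⟩
    Poly.1# ∎)

  LowestTerms : RatFun → Set
  LowestTerms A = ∃[ F ] F IsLowestTermsOf A × ∃[ g ] num A ≈ g Poly.* num F × den A ≈ g Poly.* den F

  unit-common : ∀ {d} g e → d ≈ g Poly.* e → Unitʷ d → Unitʷ g
  unit-common {d} g e d≈ U =
    unit-factorʷ {e} {g} (unit-congʷ {d} {e Poly.* g} (R/w.fromEq (trans d≈ (*-comm g e))) U)

  denominatorCoprime : ∀ A → Unitʷ (den A) → LowestTerms A → A HasDenominatorCoprimeTo w
  denominatorCoprime A U (F , lowest , g , num≈ , den≈) = F , lowest ,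
    unit⇒coprime {den F} (unit-factorʷ {g} {den F} (unit-congʷ {den A} {g Poly.* den F} (R/w.fromEq den≈) U))

  ≈0⇒∣ : ∀ {P} → P R/w².≈ₘ Poly.0# → (w Poly.^ 2) Poly.∣ P
  ≈0⇒∣ (k R/w²., e) = k , sym e

  -- The cancelled factor g divides `den A`, so it is a unit modulo w and hence modulo w². Since g
  -- times `num F` is zero modulo w², so is `num F`.
  numerator∣ : ∀ A → Unitʷ (den A) → num A R/w².≈ₘ Poly.0# → LowestTerms A →
               ∃[ F ] F IsLowestTermsOf A × (w Poly.^ 2) Poly.∣ num F
  numerator∣ A U num≈0 (F , lowest , g , num≈ , den≈) = F , lowest , ≈0⇒∣ {num F}
    (unit-cancelʷ² {g} {num F} (unit-lift {g} (unit-common g (den F) den≈ U))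
      (S.trans {g Poly.* num F} {num A} {Poly.0#} (R/w².fromEq (sym num≈)) num≈0))
    where module S = CommutativeRing R/w².quotientRing

  -- Reduces a statement about lowest terms to unreduced data: denominators that are units modulo w,
  -- and a common value modulo w².
  congruence : ∀ A B x → Unitʷ (den A) → Unitʷ (den B) → Value A x → Value B x →
               A ≡ B [mod w ^ 2 ]
  congruence A B x UA UB VA VB = record
    { denominatorˡ = denominatorCoprime A UA (lowestTerms A)
    ; denominatorʳ = denominatorCoprime B UB (lowestTerms B)
    ; difference   = numerator∣ (A RF.- B) (unit-*ʷ {den A} {den B} UA UB)
                       (difference-value A B x VA VB) (lowestTerms (A RF.- B))
    }

-- Invertibility of p and the exponent of q

n·1≈const : ∀ n → ∃[ c ] ℚ.NonNegative c × Poly.sum {n} (λ _ → Poly.1#) Poly.≈ Poly.const c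
n·1≈const zero    = 0ℚ , _ , Poly.coeffs-≡ λ where
  zero    → ≡.refl
  (suc n) → ≡.refl
n·1≈const (suc n) with n·1≈const n
... | c , c≥0 , e = 1ℚ ℚ.+ c , ℚ.nonNeg+nonNeg⇒nonNeg 1ℚ c {{c≥0}} , CommutativeRing.+-congˡ polyRing {Poly.1#} e

-- The constant is 1 + c with c ≥ 0, a positive rational; this is why nonnegativity is tracked.
1+n·1-unit : ∀ n → ∃[ u ] u Poly.* Poly.sum {suc n} (λ _ → Poly.1#) Poly.≈ Poly.1#
1+n·1-unit n with n·1≈const n
... | c , c≥0 , e = Poly.const (ℚ.1/ (1ℚ ℚ.+ c)) , P.trans
  (P.*-congˡ {Poly.const (ℚ.1/ (1ℚ ℚ.+ c))} (P.+-congˡ {Poly.1#} e))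
  (constants-multiply {ℚ.1/ (1ℚ ℚ.+ c)} {1ℚ ℚ.+ c} (ℚ.*-inverseˡ (1ℚ ℚ.+ c)))
  where
  module P = CommutativeRing polyRing
  instance
    _ = ℚ.pos⇒nonZero (1ℚ ℚ.+ c) {{ℚ.pos+nonNeg⇒pos 1ℚ c {{c≥0}}}}

odd⇒1+2* : ∀ p → ¬ (2 ∣ p) → ∃[ m ] p ≡ suc (2 ℕ.* m)
odd⇒1+2* zero          2∤p = contradiction (ℕ∣.divides 0 ≡.refl) 2∤p
odd⇒1+2* (suc zero)    2∤p = 0 , ≡.refl
odd⇒1+2* (suc (suc p)) 2∤p with odd⇒1+2* p (λ 2∣p → 2∤p (∣m∣n⇒∣m+n ∣-refl 2∣p))
... | m , ≡.refl = suc m , ≡.cong (λ k → suc (suc k)) (≡.sym (ℕ.+-suc m (m ℕ.+ 0)))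

-- `/ℕ` rounds down when a negative dividend leaves a remainder. For an exact multiple the remainder
-- is zero and the quotient is just negated.
-[1+m]/ℕ : ∀ m k d .{{_ : ℕ.NonZero d}} → suc m ≡ k ℕ.* d → -[1+ m ] ℤ./ℕ d ≡ ℤ.- (+ k)
-[1+m]/ℕ m k d e rewrite ≡.trans (≡.cong (_% d) e) (m*n%n≡0 k d) =
  ≡.cong (λ x → ℤ.- (+ x)) (≡.trans (≡.cong (_/ d) e) (m*n/n≡m k d))

-- p² - 1 = 4N(N + 1) for p = 2N + 1, here with N = n + 1.
exponent : ∀ n → (1ℤ ℤ.- + (suc (2 ℕ.* suc n) ℕ.^ 2)) ℤ./ℕ 4 ≡ ℤ.- (+ (suc n ℕ.* suc (suc n)))
exponent n = ≡.trans (≡.cong (λ x → (1ℤ ℤ.- + x) ℤ./ℕ 4) (square (suc n)))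
  (-[1+m]/ℕ _ (suc n ℕ.* suc (suc n)) 4 ≡.refl)
  where
  square : ∀ m → suc (2 ℕ.* m) ℕ.* (suc (2 ℕ.* m) ℕ.* 1) ≡ suc (m ℕ.* suc m ℕ.* 4)
  square = solve-∀

-- The congruence for rational functions of q

module P = CommutativeRing polyRing
module P^ = SemiringExp P.semiring
module PΣ = SemiringSum P.semiring

poly-^ : ∀ x n → x P^.^ n ≡ x Poly.^ n
poly-^ x zero    = ≡.refl
poly-^ x (suc n) = ≡.cong (x Poly.*_) (poly-^ x n)

poly-poch : ∀ a b n → QShifted.poch polyRing a b n ≡ ⦅ a ⨾ b ⦆ n
poly-poch a b zero    = ≡.refl
poly-poch a b (suc n) = ≡.cong₂ Poly._*_ (poly-poch a b n)
  (≡.cong (λ x → Poly.1# Poly.+ Poly.- (a Poly.* x)) (poly-^ b n))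

poly-sum : ∀ {n} {f g : Fin n → Poly} → (∀ i → f i ≡ g i) → PΣ.sum f ≡ Poly.sum g
poly-sum {zero}  f≡g = ≡.refl
poly-sum {suc n} f≡g = ≡.cong₂ Poly._+_ (f≡g zero) (poly-sum {n} (f≡g ∘ suc))

geometric≈[] : ∀ p → Units.geometric polyRing Poly.q p Poly.≈ [ p ]
geometric≈[] p = P.reflexive (poly-sum {p} (λ i → poly-^ Poly.q (toℕ i)))

2-unit : Units.Unit polyRing (Poly.1# Poly.+ Poly.1#)
2-unit = Poly.const ½ , constants-multiply {½} {1ℚ ℚ.+ 1ℚ} ≡.refl

n·1-unit : ∀ n p → p ≡ suc n → Units.Unit polyRing (Summation.∑< polyRing p (λ _ → Poly.1#))
n·1-unit n p ≡.refl = ≡.subst (Units.Unit polyRing) 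
  (≡.sym (poly-sum {suc n} {λ _ → Poly.1#} {λ _ → Poly.1#} (λ _ → ≡.refl))) (1+n·1-unit n)

SignCases : ℕ → ℕ → Set
SignCases N p = (∃[ m ] N ≡ 2 ℕ.* m × legendre -1ℤ p ≡ 1ℤ) ⊎
                (∃[ m ] N ≡ suc (2 ℕ.* m) × legendre -1ℤ p ≡ -1ℤ)

legendre≈sign : ∀ N p → SignCases N p →
                Poly.const (legendre -1ℤ p ℚ./ 1) Poly.≈ (Poly.- Poly.1#) P^.^ N
legendre≈sign N p (inj₁ (m , N≡ , leg)) = P.trans
  (P.reflexive (≡.cong (λ l → Poly.const (l ℚ./ 1)) leg))
  (P.sym (P.trans (P.reflexive (≡.cong ((Poly.- Poly.1#) P^.^_) N≡)) (Signs.[-1]^even polyRing m)))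
legendre≈sign N p (inj₂ (m , N≡ , leg)) = P.trans
  (P.reflexive (≡.cong (λ l → Poly.const (l ℚ./ 1)) leg))
  (P.sym (P.trans (P.reflexive (≡.cong ((Poly.- Poly.1#) P^.^_) N≡)) (Signs.[-1]^odd polyRing m)))

-- Here suc K = (p² - 1)/4, so q^ -[1+ K ] is the power of q in the theorem.
module TruncatedSum (N p : ℕ) (p≡ : p ≡ suc (2 ℕ.* N)) (2<p : 2 < p) (p-prime : Prime p)
  (sign : SignCases N p) (K : ℕ) (K≡ : N ℕ.* suc N ≡ suc K) (s : ℕ) (s≤N : s ≤ N) where

  open Poly using (q)
  open SumModuloSquare polyRing q q² [ p ] P.refl N p p≡ 2<p p-prime
    (geometric≈[] p) 2-unit (n·1-unit (2 ℕ.* N) p p≡)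
  module ≡ᵣ = Congruence [ p ]
  module V = Evaluation ([ p ] Poly.^ 2)
  module Mᵤ = Units (QuotientRing.quotientRing polyRing [ p ])
  module Mₑ = Evaluation [ p ]

  term : ℕ → RatFun
  term k = (⦅ q ⨾ q² ⦆ k Poly.* ⦅ q ⨾ q² ⦆ (k ℕ.+ s)) over (⦅ q² ⨾ q² ⦆ k Poly.* ⦅ q² ⨾ q² ⦆ (k ℕ.+ s))
           ⟨ *-≉0 (⦅q²⨾q²⦆≉0 k) (⦅q²⨾q²⦆≉0 (k ℕ.+ s)) ⟩

  signTimesPower : RatFun
  signTimesPower = RF.fromℤ (legendre -1ℤ p) RF.* RF.q^ -[1+ K ]

  toℕ≤N : (i : Fin (suc N)) → toℕ i ≤ N
  toℕ≤N i = ℕ.s≤s⁻¹ (Fin.toℕ<n i)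

  den-unit : ∀ k → k ≤ 2 ℕ.* N → Mᵤ.Unit (⦅ q² ⨾ q² ⦆ k)
  den-unit k k≤2N = ≡.subst Mᵤ.Unit (poly-poch q² q² k) (poch-unit k k≤2N)

  term-unit : ∀ k → k ≤ N → Mᵤ.Unit (den (term k))
  term-unit k k≤N = Mᵤ.unit-* {⦅ q² ⨾ q² ⦆ k} {⦅ q² ⨾ q² ⦆ (k ℕ.+ s)}
    (den-unit k (k≤2N k≤N)) (den-unit (k ℕ.+ s) (k+s≤2N k≤N s≤N))

  q^N[1+N] : q P^.^ (N ℕ.* suc N) ≡ q Poly.^ suc K
  q^N[1+N] = ≡.trans (poly-^ q (N ℕ.* suc N)) (≡.cong (q Poly.^_) K≡)

  signTimesPower-unit : Mᵤ.Unit (den signTimesPower)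
  signTimesPower-unit = Mᵤ.unit-* {Poly.1#} {q Poly.^ suc K} Mᵤ.unit-1
    (≡.subst Mᵤ.Unit q^N[1+N] (q^-unit (N ℕ.* suc N)))

  -- The values of the summands are an abstract `v`, known only through their equations.
  congruence-from : ∃[ v ] IsTermValue s s≤N v →
    (∑[ k ≤ N ] term k) ≡ signTimesPower [mod [ p ] ^ 2 ]
  congruence-from (v , v-value) = ≡ᵣ.congruence (∑[ k ≤ N ] term k) signTimesPower total
    (Mₑ.sum-unit {suc N} (term ∘ toℕ) (λ i → term-unit (toℕ i) (toℕ≤N i)))
    signTimesPower-unit
    (≡.subst (λ t → V.Value (∑[ k ≤ N ] term k) t) total≡
      (V.sum-value {suc N} (term ∘ toℕ) (v ∘ toℕ) (λ i → term-value (toℕ i) (toℕ≤N i))))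
    (≡.subst (λ t → num signTimesPower ≈ₘ total Poly.* (Poly.1# Poly.* t)) q^N[1+N]
      (sum-value s s≤N v v-value (legendre≈sign N p sign)))
    where
    open QuotientRing polyRing ([ p ] Poly.^ 2) using (_≈ₘ_)
    total : Poly
    total = Summation.∑< polyRing (suc N) v
    total≡ : _ ≡ total
    total≡ = QuotientTransfer.sum-≡ polyRing ([ p ] Poly.^ 2) {suc N} {v ∘ toℕ} {v ∘ toℕ} (λ _ → ≡.refl)
    term-value : ∀ k → k ≤ N → V.Value (term k) (v k)
    term-value k k≤N = ≡.subst₂ (λ a b → a ≈ₘ v k Poly.* b)
      (≡.cong₂ Poly._*_ (poly-poch q q² k) (poly-poch q q² (k ℕ.+ s)))
      (≡.cong₂ Poly._*_ (poly-poch q² q² k) (poly-poch q² q² (k ℕ.+ s)))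
      (v-value k k≤N)

  congruence : (∑[ k ≤ N ] term k) ≡ signTimesPower [mod [ p ] ^ 2 ]
  congruence = congruence-from (termValues s s≤N)

-- The upper limit and the exponent are parameters, so that the two integer divisions in the theorem
-- can be replaced by their values.
SumCongruence : ℕ → ℕ → ℕ → ℤ → Set
SumCongruence p s N e =
  (∑[ k ≤ N ]
    ((⦅ Poly.q ⨾ q² ⦆ k Poly.* ⦅ Poly.q ⨾ q² ⦆ (k ℕ.+ s))
      over (⦅ q² ⨾ q² ⦆ k Poly.* ⦅ q² ⨾ q² ⦆ (k ℕ.+ s))
      ⟨ *-≉0 (⦅q²⨾q²⦆≉0 k) (⦅q²⨾q²⦆≉0 (k ℕ.+ s)) ⟩))
  ≡ RF.fromℤ (legendre -1ℤ p) RF.* RF.q^ e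
  [mod [ p ] ^ 2 ]

sumCongruence-odd : ∀ p → Prime p → ∃[ m ] p ≡ suc (2 ℕ.* m) → ∀ s → s ≤ (p ∸ 1) / 2 →
  SumCongruence p s ((p ∸ 1) / 2) ((1ℤ ℤ.- + (p ℕ.^ 2)) ℤ./ℕ 4)
sumCongruence-odd p p-prime (zero  , p≡1) s s≤ = contradiction (≡.subst Prime p≡1 p-prime) ¬prime[1]
sumCongruence-odd p p-prime (suc n , p≡)  s s≤ =
  ≡.subst₂ (SumCongruence p s) (≡.sym half≡N) (≡.sym exponent≡)
    (TruncatedSum.congruence (suc n) p p≡ 2<p p-prime (MinusOne.legendre-minusOne n p p≡ p-prime)
      -- This is (n + 1)(n + 2) - 1, in the form to which the product unfolds, so that `refl`
      -- suffices.
      (suc n ℕ.+ n ℕ.* suc (suc n)) ≡.refl s (≡.subst (s ≤_) half≡N s≤))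
  where
  2<p : 2 ℕ.< p
  2<p = ≡.subst (2 ℕ.<_) (≡.sym p≡) (s≤s (ℕ.*-monoʳ-≤ 2 (s≤s (z≤n {n}))))
  half≡N : (p ∸ 1) / 2 ≡ suc n
  half≡N = ≡.trans (≡.cong (λ m → (m ∸ 1) / 2) p≡)
    (≡.trans (≡.cong (_/ 2) (ℕ.*-comm 2 (suc n))) (m*n/n≡m (suc n) 2))
  exponent≡ : (1ℤ ℤ.- + (p ℕ.^ 2)) ℤ./ℕ 4 ≡ -[1+ suc n ℕ.+ n ℕ.* suc (suc n) ]
  exponent≡ = ≡.trans (≡.cong (λ m → (1ℤ ℤ.- + (m ℕ.^ 2)) ℤ./ℕ 4) p≡) (exponent n)

theorem2p6 : (p : ℕ) → Prime p → ¬ (2 ∣ p) → (s : ℕ) → s ≤ (p ∸ 1) / 2 →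
    (∑[ k ≤ (p ∸ 1) / 2 ]
      ((⦅ Poly.q ⨾ q² ⦆ k Poly.* ⦅ Poly.q ⨾ q² ⦆ (k ℕ.+ s))
        over (⦅ q² ⨾ q² ⦆ k Poly.* ⦅ q² ⨾ q² ⦆ (k ℕ.+ s))
        ⟨ *-≉0 (⦅q²⨾q²⦆≉0 k) (⦅q²⨾q²⦆≉0 (k ℕ.+ s)) ⟩))
    ≡ RF.fromℤ (legendre -1ℤ p) RF.* RF.q^ ((1ℤ ℤ.- + (p ℕ.^ 2)) ℤ./ℕ 4)
    [mod [ p ] ^ 2 ]
theorem2p6 p p-prime 2∤p = sumCongruence-odd p p-prime (odd⇒1+2* p 2∤p)
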